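{- Let $p$ be a prime with $p\equiv 11$ or $19 \pmod{20}$. Then for all integers $n,k\geq 0$ with $p\nmid n$, \[ c_{9,1}\left(8p^{2k+1}n+\frac{6p^{2k+2}+4}{5}\right)\equiv 0 \pmod 2 \quad\text{and}\quad c_{9,1}\left(8p^{2k+1}n+\frac{26p^{2k+2}+4}{5}\right)\equiv 0 \pmod 2. \]
   Context: For complex $a,b$ the false theta function is $\Psi(a,b):=\sum_{n=0}^\infty a^{n(n+1)/2}b^{n(n-1)/2}-\sum_{n=-\infty}^{ -1}a^{n(n+1)/2}b^{n(n-1)/2}$. For positive integers $r,s$, the integers $c_{r,s}(n)$ ($n\ge 0$) are defined by the power series identity $\sum_{n=0}^\infty c_{r,s}(n)q^n=\dfrac{1}{\Psi(-q^r,q^s)}$ (the denominator is a power series in $q$ with constant term $1$). -}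

module Defs where

open import Data.Nat as ℕ using (ℕ; zero; suc)
open import Data.Nat.DivMod using (_/_; _%_)
open import Data.Integer as ℤ using (ℤ; +_; -_)
open import Data.List using (List; []; _∷_; map; foldr; zipWith; upTo)
open import Data.Bool using (if_then_else_)

sumℤ : List ℤ → ℤ
sumℤ = foldr ℤ._+_ (+ 0)

tri : ℕ → ℕ
tri n = (n ℕ.* suc n) / 2

sgn : ℕ → ℤ
sgn e = if (e % 2) ℕ.≡ᵇ 0 then + 1 else - (+ 1)

-- Ψ(-q^r, q^s) = Σ_{n≥0} (-1)^{T(n)} q^{r T(n) + s T(n-1)}
--              - Σ_{m≥1} (-1)^{T(m-1)} q^{r T(m-1) + s T(m)}
-- (term n = -m, m ≥ 1, of the second sum).  Since r,s ≥ 1 every exponent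
-- of the index n (resp. m) is ≥ n (resp. ≥ m), so the coefficient of q^N
-- only receives contributions from indices ≤ N.

expPos : ℕ → ℕ → ℕ → ℕ
expPos r s zero    = 0
expPos r s (suc n) = r ℕ.* tri (suc n) ℕ.+ s ℕ.* tri n

-- exponent of the term with index n = -(m+1), m ≥ 0
expNeg : ℕ → ℕ → ℕ → ℕ
expNeg r s m = r ℕ.* tri m ℕ.+ s ℕ.* tri (suc m)

when : ℕ → ℕ → ℤ → ℤ
when a b z = if a ℕ.≡ᵇ b then z else + 0

psiCoeff : ℕ → ℕ → ℕ → ℤ
psiCoeff r s N =
  sumℤ (map (λ n → when (expPos r s n) N (sgn (tri n))) (upTo (suc N)))
  ℤ.+ sumℤ (map (λ m → when (expNeg r s m) N (- sgn (tri m))) (upTo (suc N)))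

-- cList r s N = [c(N), c(N-1), …, c(0)] where Σ c(n) q^n = 1 / Ψ(-q^r, q^s),
-- computed by the standard recursion for the inverse of a power series with
-- constant term 1:  c(0) = 1,  c(N) = - Σ_{j=1}^{N} d(j) c(N-j).
cList : ℕ → ℕ → ℕ → List ℤ
cList r s zero    = + 1 ∷ []
cList r s (suc N) =
  - sumℤ (zipWith ℤ._*_ (map (λ j → psiCoeff r s (suc j)) (upTo (suc N)))
                       (cList r s N))
  ∷ cList r s N

headZ : List ℤ → ℤ
headZ []      = + 0
headZ (x ∷ _) = x

c : ℕ → ℕ → ℕ → ℤ
c r s N = headZ (cList r s N)

{-# OPTIONS --safe #-}
module Submission where

-- Work in 𝔽₂[[q]], and let θ r s = Σ_{n ∈ ℤ} q^(r n(n+1)/2 + s n(n-1)/2).  Modulo 2 the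
-- series to be inverted is F = θ 9 1, and a(q)² = a(q²).  Hence 1/F = F/F(q²), so that
-- taking even and then odd parts gives
--   F · Σ c(4n+2) qⁿ = θ 7 3 · (θ 4 1)⁴.
-- A rotation of ℤ² yields F · θ 6 4 = θ 4 1 · θ 15 5 and θ 7 3 · θ 8 2 = θ 3 2 · θ 15 5, whence
--   Σ c(4n+2) qⁿ = θ 6 4 · (θ 4 1 · θ 3 2).
-- The product θ 4 1 · θ 3 2 counts, up to units, the Gaussian integers of norm 4n+1 that are not
-- divisible by 1+2i: all of them minus (1+2i) times those of norm (4n+1)/5.  Both counts reduce
-- modulo 2 to the classes fixed by conjugation, which leaves θ 6 2 + q θ 30 10.  Therefore
--   Σ c(8n+2) qⁿ = θ 3 2 · θ 3 1   and   Σ c(8n+6) qⁿ = θ 3 2 · θ 15 5,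
-- so an odd c(8n+2) forces 40n+6 = x²+5y², and an odd c(8n+6) forces 40n+26 = x²+y².
-- For the arguments in question these numbers have odd p-adic valuation, while -1 and -5 are
-- non-residues modulo p: by Thue's lemma, p ∣ x²+dy² with p ∤ y would make a multiple kp with
-- 0 < k ≤ d+1 a value of the form, which congruences exclude for d = 1 and d = 5.

open import Defs
open import Algebra.Bundles using (CommutativeMonoid)
open import Algebra.Properties.AbelianGroup using (∙-cancelˡ)
open import Algebra.Properties.CommutativeSemigroup using (interchange)
open import Data.Bool using (T; true; false; if_then_else_)
open import Data.Empty using (⊥-elim)
open import Data.Fin using (Fin; zero; suc; toℕ; fromℕ<; remQuot; combine)
open import Data.Fin.Patterns using (0F; 1F; 2F; 3F; 4F)
open import Data.Fin.Permutation using (↔⇒≡)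
import Data.Fin.Properties as Fin
open import Data.Integer using (ℤ; +_; -[1+_])
import Data.Integer as ℤ
import Data.Integer.Properties as ℤ
open import Data.Integer.DivMod using (_/ℕ_; _%ℕ_; n%ℕd<d; a≡a%ℕn+[a/ℕn]*n)
open import Data.Integer.Divisibility using () renaming (_∣_ to _∣ℤ_)
open import Data.Integer.Divisibility.Signed
  using (∣ᵤ⇒∣; ∣⇒∣ᵤ; ∣m∣n⇒∣m+n; ∣m∣n⇒∣m-n; ∣n⇒∣m*n; ∣m⇒∣m*n)
  renaming (_∣_ to _∣ₛ_; divides to dividesₛ; _∣?_ to _∣ₛ?_)
open import Data.Integer.Solver using (module +-*-Solver)
open import Data.Integer.Tactic.RingSolver using () renaming (solve-∀ to ℤ-solve-∀)
open import Data.List using (map; zipWith; upTo; applyUpTo)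
open import Data.Nat using (ℕ; zero; suc; _+_; _*_; _^_; _≤_; _<_; _≤?_; _≡ᵇ_; z≤n; s≤s; s≤s⁻¹; parity; NonZero; ≢-nonZero⁻¹)
import Data.Nat.Properties as ℕ
open import Data.Nat.DivMod using (_/_; _%_; m*n/n≡m; +-distrib-/-∣ʳ; [m+kn]%n≡m%n; m%n<n; m≡m%n+[m/n]*n)
open import Data.Nat.Divisibility using (_∣_; divides; _∣?_; ∣m+n∣m⇒∣n; m∣m*n; n∣m*n; ∣⇒≤)
open import Data.Nat.Primality using (Prime; euclidsLemma; prime⇒nonZero)
open import Data.Nat.Tactic.RingSolver using () renaming (solve-∀ to ℕ-solve-∀)
open import Data.Parity.Base as ℙ using (Parity; 0ℙ; 1ℙ) renaming (_+_ to infixl 6 _⊕_; _*_ to infixl 7 _⊗_)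
import Data.Parity.Properties as ℙ
open import Data.Product using (_×_; _,_; Σ; ∃; proj₁; proj₂; uncurry)
open import Data.Product.Function.NonDependent.Propositional using (_×-↔_)
open import Data.Sum using (_⊎_; inj₁; inj₂; [_,_]; [_,_]′)
open import Data.Sum.Function.Propositional using (_⊎-↔_)
open import Data.Unit using (tt)
open import Function using (_∘_; id)
open import Function.Bundles using (_↔_; mk↔ₛ′; module Inverse)
open import Function.Properties.Inverse using (↔-sym; ↔-trans)
open import Level using (0ℓ)
open import Relation.Binary.Bundles using (Setoid)
open import Relation.Binary.PropositionalEquality
  using (_≡_; _≗_; refl; sym; trans; cong; cong₂; subst; subst₂; subst-injective; _→-setoid_; module ≡-Reasoning)
open import Relation.Nullary using (¬_; Dec; yes; no; ¬?; contradiction; _→-dec_; _⊎-dec_)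
open import Relation.Nullary.Decidable using (True; toWitness; decidable-stable)
open Inverse using (to; from; strictlyInverseˡ; strictlyInverseʳ)
open ≡-Reasoning

-- Power series over 𝔽₂

Series : Set
Series = ℕ → Parity

infixl 7 _⊛_

-- Peeling the left factor matches the order in which `zipWith` pairs the coefficients of Ψ with
-- `cList`, whose head is the latest coefficient.
_⊛_ : Series → Series → Series
(a ⊛ b) zero    = a 0 ⊗ b 0
(a ⊛ b) (suc n) = a 0 ⊗ b (suc n) ⊕ ((a ∘ suc) ⊛ b) n

δ : Series
δ zero    = 1ℙ
δ (suc _) = 0ℙ

⊛-cong : ∀ {a a′ b b′} → a ≗ a′ → b ≗ b′ → a ⊛ b ≗ a′ ⊛ b′
⊛-cong p q zero    = cong₂ _⊗_ (p 0) (q 0)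
⊛-cong p q (suc n) =
  cong₂ _⊕_ (cong₂ _⊗_ (p 0) (q (suc n))) (⊛-cong (p ∘ suc) q n)

-- The mirror of the defining recursion, peeling the right factor instead; commutativity and
-- squaring both rest on it.
⊛-suc : ∀ a b n → (a ⊛ b) (suc n) ≡ (a ⊛ (b ∘ suc)) n ⊕ a (suc n) ⊗ b 0
⊛-suc a b zero    = refl
⊛-suc a b (suc n) = trans
  (cong (a 0 ⊗ b (suc (suc n)) ⊕_) (⊛-suc (a ∘ suc) b n))
  (sym (ℙ.+-assoc (a 0 ⊗ b (suc (suc n))) _ _))

⊛-comm : ∀ a b → a ⊛ b ≗ b ⊛ a
⊛-comm a b zero    = ℙ.*-comm (a 0) (b 0)
⊛-comm a b (suc n) = begin
  a 0 ⊗ b (suc n) ⊕ ((a ∘ suc) ⊛ b) n ≡⟨ cong₂ _⊕_ (ℙ.*-comm (a 0) _) (⊛-comm (a ∘ suc) b n) ⟩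
  b (suc n) ⊗ a 0 ⊕ (b ⊛ (a ∘ suc)) n ≡⟨ ℙ.+-comm (b (suc n) ⊗ a 0) _ ⟩
  (b ⊛ (a ∘ suc)) n ⊕ b (suc n) ⊗ a 0 ≡⟨ ⊛-suc b a n ⟨
  (b ⊛ a) (suc n)                     ∎

⊛-scaleˡ : ∀ x a b n → ((λ k → x ⊗ a k) ⊛ b) n ≡ x ⊗ (a ⊛ b) n
⊛-scaleˡ x a b zero    = ℙ.*-assoc x _ _
⊛-scaleˡ x a b (suc n) = trans
  (cong₂ _⊕_ (ℙ.*-assoc x _ _) (⊛-scaleˡ x (a ∘ suc) b n))
  (sym (ℙ.*-distribˡ-+ x (a 0 ⊗ b (suc n)) _))

⊛-distribʳ : ∀ a b d n → ((λ k → a k ⊕ b k) ⊛ d) n ≡ (a ⊛ d) n ⊕ (b ⊛ d) n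
⊛-distribʳ a b d zero    = ℙ.*-distribʳ-+ (d 0) (a 0) (b 0)
⊛-distribʳ a b d (suc n) = trans
  (cong₂ _⊕_ (ℙ.*-distribʳ-+ (d (suc n)) (a 0) (b 0)) (⊛-distribʳ (a ∘ suc) (b ∘ suc) d n))
  (interchange ℙ.+-commutativeSemigroup (a 0 ⊗ d (suc n)) (b 0 ⊗ d (suc n)) (((a ∘ suc) ⊛ d) n) (((b ∘ suc) ⊛ d) n))

⊛-assoc : ∀ a b d → (a ⊛ b) ⊛ d ≗ a ⊛ (b ⊛ d)
⊛-assoc a b d zero    = ℙ.*-assoc (a 0) _ _
⊛-assoc a b d (suc n) = begin
  (a 0 ⊗ b 0) ⊗ d (suc n) ⊕ (((a ⊛ b) ∘ suc) ⊛ d) n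
    ≡⟨ cong₂ _⊕_ (ℙ.*-assoc (a 0) _ _) (⊛-distribʳ (λ k → a 0 ⊗ b (suc k)) ((a ∘ suc) ⊛ b) d n) ⟩
  a 0 ⊗ (b 0 ⊗ d (suc n)) ⊕ (((λ k → a 0 ⊗ b (suc k)) ⊛ d) n ⊕ (((a ∘ suc) ⊛ b) ⊛ d) n)
    ≡⟨ cong (a 0 ⊗ (b 0 ⊗ d (suc n)) ⊕_)
         (cong₂ _⊕_ (⊛-scaleˡ (a 0) (b ∘ suc) d n) (⊛-assoc (a ∘ suc) b d n)) ⟩
  a 0 ⊗ (b 0 ⊗ d (suc n)) ⊕ (a 0 ⊗ ((b ∘ suc) ⊛ d) n ⊕ ((a ∘ suc) ⊛ (b ⊛ d)) n)
    ≡⟨ ℙ.+-assoc (a 0 ⊗ (b 0 ⊗ d (suc n))) _ _ ⟨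
  (a 0 ⊗ (b 0 ⊗ d (suc n)) ⊕ a 0 ⊗ ((b ∘ suc) ⊛ d) n) ⊕ ((a ∘ suc) ⊛ (b ⊛ d)) n
    ≡⟨ cong (_⊕ ((a ∘ suc) ⊛ (b ⊛ d)) n) (ℙ.*-distribˡ-+ (a 0) (b 0 ⊗ d (suc n)) _) ⟨
  (a ⊛ (b ⊛ d)) (suc n) ∎

⊛-zeroˡ : ∀ {a} b → (∀ n → a n ≡ 0ℙ) → ∀ n → (a ⊛ b) n ≡ 0ℙ
⊛-zeroˡ b a≡0 zero    rewrite a≡0 0 = refl
⊛-zeroˡ b a≡0 (suc n) rewrite a≡0 0 = ⊛-zeroˡ b (a≡0 ∘ suc) n

⊛-identityˡ : ∀ a → δ ⊛ a ≗ a
⊛-identityˡ a zero    = refl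
⊛-identityˡ a (suc n) =
  trans (cong (a (suc n) ⊕_) (⊛-zeroˡ a (λ _ → refl) n)) (ℙ.+-identityʳ _)

⊛-identityʳ : ∀ a → a ⊛ δ ≗ a
⊛-identityʳ a n = trans (⊛-comm a δ n) (⊛-identityˡ a n)

⊛-commutativeMonoid : CommutativeMonoid 0ℓ 0ℓ
⊛-commutativeMonoid = record
  { Carrier = Series ; _≈_ = _≗_ ; _∙_ = _⊛_ ; ε = δ
  ; isCommutativeMonoid = record
    { isMonoid = record
      { isSemigroup = record
        { isMagma = record
          { isEquivalence = Setoid.isEquivalence (ℕ →-setoid Parity) ; ∙-cong = ⊛-cong }
        ; assoc = ⊛-assoc }
      ; identity = ⊛-identityˡ , ⊛-identityʳ }
    ; comm = ⊛-comm } }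

-- Dilation q ↦ q² and dissection by the parity of the exponent

dilate : Series → Series
dilate a zero          = a 0
dilate a (suc zero)    = 0ℙ
dilate a (suc (suc n)) = dilate (a ∘ suc) n

evens odds : Series → Series
evens a n = a (n * 2)
odds  a n = a (suc (n * 2))

dilate-cong : ∀ {a b} → a ≗ b → dilate a ≗ dilate b
dilate-cong p zero          = p 0
dilate-cong p (suc zero)    = refl
dilate-cong p (suc (suc n)) = dilate-cong (p ∘ suc) n

dilate-unique : ∀ a b → evens b ≗ a → (∀ n → odds b n ≡ 0ℙ) → b ≗ dilate a
dilate-unique a b p q zero          = p 0
dilate-unique a b p q (suc zero)    = q 0
dilate-unique a b p q (suc (suc n)) =
  dilate-unique (a ∘ suc) (λ m → b (suc (suc m))) (p ∘ suc) (q ∘ suc) n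

evens-dilate : ∀ a → evens (dilate a) ≗ a
evens-dilate a zero    = refl
evens-dilate a (suc n) = evens-dilate (a ∘ suc) n

odds-dilate : ∀ a n → odds (dilate a) n ≡ 0ℙ
odds-dilate a zero    = refl
odds-dilate a (suc n) = odds-dilate (a ∘ suc) n

-- A series in q² shifts exponents only by even amounts, so it passes through the extraction of even
-- terms, and likewise of odd terms.
evens-dilate-⊛ : ∀ a b → evens (dilate a ⊛ b) ≗ a ⊛ evens b
evens-dilate-⊛ a b zero    = refl
evens-dilate-⊛ a b (suc n) =
  cong (a 0 ⊗ b (suc n * 2) ⊕_) (evens-dilate-⊛ (a ∘ suc) b n)

odds-dilate-⊛ : ∀ a b → odds (dilate a ⊛ b) ≗ a ⊛ odds b
odds-dilate-⊛ a b zero    = ℙ.+-identityʳ _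
odds-dilate-⊛ a b (suc n) =
  cong (a 0 ⊗ b (suc (suc n * 2)) ⊕_) (odds-dilate-⊛ (a ∘ suc) b n)

-- Frobenius in characteristic 2. The recursion removes the first and the last term of the
-- convolution, which are equal and cancel, and leaves the square of the shifted series.
⊛-square : ∀ a → a ⊛ a ≗ dilate a
⊛-square a zero          = ℙ.*-idem (a 0)
⊛-square a (suc zero)    =
  trans (cong (a 0 ⊗ a 1 ⊕_) (ℙ.*-comm (a 1) (a 0))) (ℙ.p+p≡0ℙ (a 0 ⊗ a 1))
⊛-square a (suc (suc n)) = begin
  x ⊕ ((a ∘ suc) ⊛ a) (suc n)     ≡⟨ cong (x ⊕_) (⊛-suc (a ∘ suc) a n) ⟩
  x ⊕ (y ⊕ a (suc (suc n)) ⊗ a 0) ≡⟨ cong (λ z → x ⊕ (y ⊕ z)) (ℙ.*-comm _ (a 0)) ⟩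
  x ⊕ (y ⊕ x)                     ≡⟨ cong (x ⊕_) (ℙ.+-comm y x) ⟩
  x ⊕ (x ⊕ y)                     ≡⟨ ℙ.+-assoc x x y ⟨
  (x ⊕ x) ⊕ y                     ≡⟨ cong (_⊕ y) (ℙ.p+p≡0ℙ x) ⟩
  y                               ≡⟨ ⊛-square (a ∘ suc) n ⟩
  dilate (a ∘ suc) n              ∎
  where
  x y : Parity
  x = a 0 ⊗ a (suc (suc n))
  y = ((a ∘ suc) ⊛ (a ∘ suc)) n

-- Applied with `F` = `θ 9 1`, `G` = `θ 7 3`, `K` = `θ 4 1`, `L` = `θ 3 2`, `P` = `θ 15 5`. By
-- `⊛-square` every `dilate` is a square, so `dilate (dilate K)` is K⁴.
module _ {C F G K L P : Series}
  (C-inverse : C ⊛ F ≗ δ)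
  (evens-F : evens F ≗ dilate G) (odds-F : odds F ≗ dilate (dilate K))
  (F-split : F ⊛ dilate L ≗ K ⊛ P) (G-split : G ⊛ dilate K ≗ L ⊛ P)
  where

  open CommutativeMonoid ⊛-commutativeMonoid using (∙-cong; ∙-congˡ; ∙-congʳ)
    renaming (setoid to ⊛-setoid; refl to ≗-refl; sym to ≗-sym)
  open import Algebra.Solver.CommutativeMonoid ⊛-commutativeMonoid using (solve; _⊜_) renaming (_⊕_ to _∙_)
  open import Relation.Binary.Reasoning.Setoid ⊛-setoid renaming (begin_ to begin≈_; _∎ to _∎≈)

  private
    -- C F² = F, and F² is F(q²) modulo 2.
    dilate-F : dilate F ⊛ C ≗ F
    dilate-F = begin≈
      dilate F ⊛ C ≈⟨ ∙-congʳ (≗-sym (⊛-square F)) ⟩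
      F ⊛ F ⊛ C    ≈⟨ solve 2 (λ f c → (f ∙ f) ∙ c ⊜ (c ∙ f) ∙ f) ≗-refl F C ⟩
      C ⊛ F ⊛ F    ≈⟨ ∙-congʳ C-inverse ⟩
      δ ⊛ F        ≈⟨ ⊛-identityˡ F ⟩
      F            ∎≈

    evens-C : F ⊛ evens C ≗ dilate G
    evens-C = begin≈
      F ⊛ evens C          ≈⟨ ≗-sym (evens-dilate-⊛ F C) ⟩
      evens (dilate F ⊛ C) ≈⟨ (λ n → dilate-F (n * 2)) ⟩
      evens F              ≈⟨ evens-F ⟩
      dilate G             ∎≈

    -- `evens-C` is multiplied by `F` once more: each side then carries a factor in q², namely F²
    -- and `dilate G`, and the odd parts can be compared.
    odds-evens-C : F ⊛ odds (evens C) ≗ G ⊛ dilate (dilate K)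
    odds-evens-C = begin≈
      F ⊛ odds (evens C)          ≈⟨ ≗-sym (odds-dilate-⊛ F (evens C)) ⟩
      odds (dilate F ⊛ evens C)   ≈⟨ (λ n → split (suc (n * 2))) ⟩
      odds (dilate G ⊛ F)         ≈⟨ odds-dilate-⊛ G F ⟩
      G ⊛ odds F                  ≈⟨ ∙-congˡ odds-F ⟩
      G ⊛ dilate (dilate K)       ∎≈
      where
      split : dilate F ⊛ evens C ≗ dilate G ⊛ F
      split = begin≈
        dilate F ⊛ evens C    ≈⟨ ∙-congʳ (≗-sym (⊛-square F)) ⟩
        F ⊛ F ⊛ evens C       ≈⟨ solve 2 (λ f e → (f ∙ f) ∙ e ⊜ (f ∙ e) ∙ f) ≗-refl F (evens C) ⟩
        F ⊛ evens C ⊛ F       ≈⟨ ∙-congʳ evens-C ⟩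
        dilate G ⊛ F          ∎≈

  -- F D = G K⁴ = (G K²) K² = (L P) K² = (K P)(K L) = F L² (K L), and `F` is cancelled by its
  -- inverse `C`.
  quarter-dissection : odds (evens C) ≗ dilate L ⊛ (K ⊛ L)
  quarter-dissection = begin≈
    D                            ≈⟨ ≗-sym (⊛-identityˡ D) ⟩
    δ ⊛ D                        ≈⟨ ∙-congʳ (≗-sym C-inverse) ⟩
    C ⊛ F ⊛ D                    ≈⟨ ⊛-assoc C F D ⟩
    C ⊛ (F ⊛ D)                  ≈⟨ ∙-congˡ odds-evens-C ⟩
    C ⊛ (G ⊛ dilate K₂)          ≈⟨ ∙-congˡ (∙-congˡ (≗-sym (⊛-square K₂))) ⟩
    C ⊛ (G ⊛ (K₂ ⊛ K₂))          ≈⟨ ∙-congˡ (≗-sym (⊛-assoc G K₂ K₂)) ⟩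
    C ⊛ (G ⊛ K₂ ⊛ K₂)            ≈⟨ ∙-congˡ (∙-cong G-split (≗-sym (⊛-square K))) ⟩
    C ⊛ (L ⊛ P ⊛ (K ⊛ K))
      ≈⟨ solve 4 (λ c l p k → c ∙ ((l ∙ p) ∙ (k ∙ k)) ⊜ c ∙ ((k ∙ p) ∙ (k ∙ l))) ≗-refl C L P K ⟩
    C ⊛ (K ⊛ P ⊛ (K ⊛ L))        ≈⟨ ∙-congˡ (∙-congʳ (≗-sym F-split)) ⟩
    C ⊛ (F ⊛ dilate L ⊛ (K ⊛ L))
      ≈⟨ solve 4 (λ c f l m → c ∙ ((f ∙ l) ∙ m) ⊜ (c ∙ f) ∙ (l ∙ m)) ≗-refl C F (dilate L) (K ⊛ L) ⟩
    C ⊛ F ⊛ (dilate L ⊛ (K ⊛ L)) ≈⟨ ∙-congʳ C-inverse ⟩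
    δ ⊛ (dilate L ⊛ (K ⊛ L))     ≈⟨ ⊛-identityˡ _ ⟩
    dilate L ⊛ (K ⊛ L)           ∎≈
    where
    D K₂ : Series
    D  = odds (evens C)
    K₂ = dilate K

-- Counting modulo 2

-- The cardinality comes with an explicit enumeration, so bijections transport it, and
-- `HasParity-unique` is the invariance of cardinality.
HasParity : Set → Parity → Set
HasParity S b = ∃ λ n → (Fin n ↔ S) × parity n ≡ b

HasParity-↔ : ∀ {S T b} → S ↔ T → HasParity S b → HasParity T b
HasParity-↔ e (n , f , p) = n , ↔-trans f e , p

HasParity-unique : ∀ {S b b′} → HasParity S b → HasParity S b′ → b ≡ b′
HasParity-unique (m , f , p) (n , g , q) =
  trans (sym p) (trans (cong parity (↔⇒≡ (↔-trans f (↔-sym g)))) q)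

HasParity-⊎ : ∀ {S T b b′} → HasParity S b → HasParity T b′ → HasParity (S ⊎ T) (b ⊕ b′)
HasParity-⊎ (m , f , p) (n , g , q) =
  m + n , ↔-trans Fin.+↔⊎ (f ⊎-↔ g) , trans (ℙ.+-homo-+ m n) (cong₂ _⊕_ p q)

HasParity-× : ∀ {S T b b′} → HasParity S b → HasParity T b′ → HasParity (S × T) (b ⊗ b′)
HasParity-× (m , f , p) (n , g , q) =
  m * n , ↔-trans Fin.*↔× (f ×-↔ g) , trans (ℙ.*-homo-* m n) (cong₂ _⊗_ p q)

HasParity-empty : ∀ {S} → ¬ S → HasParity S 0ℙ
HasParity-empty ¬s = 0 , mk↔ₛ′ (λ ()) (⊥-elim ∘ ¬s) (λ s → ⊥-elim (¬s s)) (λ ()) , refl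

Fibre : {I : Set} → (I → ℕ) → ℕ → Set
Fibre {I} f n = Σ I λ i → f i ≡ n

Fibre-≡ : {I : Set} {f : I → ℕ} {n : ℕ} {x y : Fibre f n} → proj₁ x ≡ proj₁ y → x ≡ y
Fibre-≡ {x = i , p} {y = _ , q} refl = cong (i ,_) (ℕ.≡-irrelevant p q)

Fibre-reindex : {I J : Set} {f : I → ℕ} {g : J → ℕ} (e : I ↔ J) →
  (∀ i → f i ≡ g (to e i)) → ∀ n → Fibre f n ↔ Fibre g n
Fibre-reindex {f = f} {g} e f≡g n = mk↔ₛ′
  (λ (i , p) → to e i , trans (sym (f≡g i)) p)
  (λ (j , p) → from e j , trans (f≡g _) (trans (cong g (strictlyInverseˡ e j)) p))
  (λ (j , _) → Fibre-≡ (strictlyInverseˡ e j))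
  (λ (i , _) → Fibre-≡ (strictlyInverseʳ e i))

Fibre-⊎ : {I J : Set} {f : I ⊎ J → ℕ} → ∀ n →
  Fibre f n ↔ (Fibre (f ∘ inj₁) n ⊎ Fibre (f ∘ inj₂) n)
Fibre-⊎ n = mk↔ₛ′
  (λ { (inj₁ i , p) → inj₁ (i , p) ; (inj₂ j , p) → inj₂ (j , p) })
  (λ { (inj₁ (i , p)) → inj₁ i , p ; (inj₂ (j , p)) → inj₂ j , p })
  (λ { (inj₁ _) → refl ; (inj₂ _) → refl })
  (λ { (inj₁ _ , _) → refl ; (inj₂ _ , _) → refl })

infix 4 _Counts_

-- `a` is the reduction modulo 2 of Σ q^(f i) over i in `I`; finiteness of every fibre is part of
-- the assertion.
_Counts_ : {I : Set} → Series → (I → ℕ) → Set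
a Counts f = ∀ n → HasParity (Fibre f n) (a n)

-- The device behind the dissections and product identities of theta series below: they reduce to
-- exponent-preserving bijections of index sets.
Counts-unique : {I J : Set} {f : I → ℕ} {g : J → ℕ} {a b : Series} → (e : I ↔ J) →
  (∀ i → f i ≡ g (to e i)) → a Counts f → b Counts g → a ≗ b
Counts-unique e f≡g cf cg n =
  HasParity-unique (HasParity-↔ (Fibre-reindex e f≡g n) (cf n)) (cg n)

Counts-⊎ : {I J : Set} {f : I ⊎ J → ℕ} {a b : Series} →
  a Counts (f ∘ inj₁) → b Counts (f ∘ inj₂) → (λ n → a n ⊕ b n) Counts f
Counts-⊎ cf cg n = HasParity-↔ (↔-sym (Fibre-⊎ n)) (HasParity-⊎ (cf n) (cg n))

private
  -- Shaped after the recursion of `⊛`, so that its parity is read off directly. `Split` is the same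
  -- set with both degrees as data, which is the form a fibre of f + g takes.
  Antidiagonal : (ℕ → Set) → (ℕ → Set) → ℕ → Set
  Antidiagonal S T zero    = S 0 × T 0
  Antidiagonal S T (suc n) = (S 0 × T (suc n)) ⊎ Antidiagonal (S ∘ suc) T n

  HasParity-antidiagonal : ∀ {S T a b} → (∀ n → HasParity (S n) (a n)) →
    (∀ n → HasParity (T n) (b n)) → ∀ n → HasParity (Antidiagonal S T n) ((a ⊛ b) n)
  HasParity-antidiagonal s t zero    = HasParity-× (s 0) (t 0)
  HasParity-antidiagonal s t (suc n) =
    HasParity-⊎ (HasParity-× (s 0) (t (suc n))) (HasParity-antidiagonal (s ∘ suc) t n)

  Split : (ℕ → Set) → (ℕ → Set) → ℕ → Set
  Split S T n = Σ ℕ λ i → Σ ℕ λ j → S i × T j × i + j ≡ n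

  split→ : ∀ S T i j → S i → T j → Antidiagonal S T (i + j)
  split→ S T zero    zero    s t = s , t
  split→ S T zero    (suc j) s t = inj₁ (s , t)
  split→ S T (suc i) j       s t = inj₂ (split→ (S ∘ suc) T i j s t)

  back : ∀ S T {n} → Split S T n → Antidiagonal S T n
  back S T (i , j , s , t , refl) = split→ S T i j s t

  shift : ∀ S T {n} → Split (S ∘ suc) T n → Split S T (suc n)
  shift S T (i , j , s , t , p) = suc i , j , s , t , cong suc p

  →split : ∀ S T n → Antidiagonal S T n → Split S T n
  →split S T zero    (s , t)        = 0 , 0 , s , t , refl
  →split S T (suc n) (inj₁ (s , t)) = 0 , suc n , s , t , refl
  →split S T (suc n) (inj₂ x)       = shift S T (→split (S ∘ suc) T n x)

  antidiagonal↔ : ∀ S T n → Antidiagonal S T n ↔ Split S T n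
  antidiagonal↔ S T n = mk↔ₛ′ (→split S T n) (back S T)
    (λ { (i , j , s , t , refl) → right S T i j s t }) (left S T n)
    where
    right : ∀ S T i j (s : S i) (t : T j) →
      →split S T (i + j) (split→ S T i j s t) ≡ (i , j , s , t , refl)
    right S T zero    zero    s t = refl
    right S T zero    (suc j) s t = refl
    right S T (suc i) j       s t = cong (shift S T) (right (S ∘ suc) T i j s t)

    back-shift : ∀ S T {n} (x : Split (S ∘ suc) T n) → back S T (shift S T x) ≡ inj₂ (back (S ∘ suc) T x)
    back-shift S T (i , j , s , t , refl) = refl

    left : ∀ S T n (x : Antidiagonal S T n) → back S T (→split S T n x) ≡ x
    left S T zero    x        = refl
    left S T (suc n) (inj₁ x) = refl
    left S T (suc n) (inj₂ x) =
      trans (back-shift S T (→split (S ∘ suc) T n x)) (cong inj₂ (left (S ∘ suc) T n x))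

  split↔ : {I J : Set} {f : I → ℕ} {g : J → ℕ} → ∀ n →
    Split (Fibre f) (Fibre g) n ↔ Fibre (λ (i , j) → f i + g j) n
  split↔ n = mk↔ₛ′
    (λ { (_ , _ , (i , refl) , (j , refl) , p) → (i , j) , p })
    (λ ((i , j) , p) → _ , _ , (i , refl) , (j , refl) , p)
    (λ _ → refl)
    (λ { (_ , _ , (i , refl) , (j , refl) , p) → refl })

Counts-⊛ : {I J : Set} {f : I → ℕ} {g : J → ℕ} {a b : Series} →
  a Counts f → b Counts g → (a ⊛ b) Counts (λ (i , j) → f i + g j)
Counts-⊛ cf cg n =
  HasParity-↔ (↔-trans (antidiagonal↔ _ _ n) (split↔ n)) (HasParity-antidiagonal cf cg n)

∑ : (ℕ → Parity) → ℕ → Parity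
∑ a zero    = 0ℙ
∑ a (suc n) = a 0 ⊕ ∑ (a ∘ suc) n

χ : ℕ → ℕ → Parity
χ m n = if m ≡ᵇ n then 1ℙ else 0ℙ

private
  HasParity-≡ : ∀ m n → HasParity (m ≡ n) (χ m n)
  HasParity-≡ m n with m ≡ᵇ n in eq
  ... | true  = 1 , mk↔ₛ′ (λ _ → p) (λ _ → zero) (λ q → ℕ.≡-irrelevant p q) (λ { zero → refl }) , refl
    where
    p : m ≡ n
    p = ℕ.≡ᵇ⇒≡ m n (subst T (sym eq) tt)
  ... | false = HasParity-empty λ p → subst T eq (ℕ.≡⇒≡ᵇ m n p)

  HasParity-Σ : ∀ {P : ℕ → Set} {a} → (∀ n → HasParity (P n) (a n)) →
    ∀ m → HasParity (Σ (Fin m) (P ∘ toℕ)) (∑ a m)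
  HasParity-Σ p zero    = HasParity-empty λ ()
  HasParity-Σ p (suc m) = HasParity-↔
    (mk↔ₛ′ (λ { (inj₁ x) → zero , x ; (inj₂ (k , x)) → suc k , x })
           (λ { (zero , x) → inj₁ x ; (suc k , x) → inj₂ (k , x) })
           (λ { (zero , x) → refl ; (suc k , x) → refl })
           (λ { (inj₁ x) → refl ; (inj₂ (k , x)) → refl }))
    (HasParity-⊎ (p 0) (HasParity-Σ (p ∘ suc) m))

-- Since m ≤ f m, the fibre over n lies among the indices m ≤ n, and the truncated sum misses
-- nothing.
Counts-∑ : ∀ {f} → (∀ n → n ≤ f n) → (λ n → ∑ (λ m → χ (f m) n) (suc n)) Counts f
Counts-∑ {f} m≤f n = HasParity-↔
  (mk↔ₛ′ (λ (k , p) → toℕ k , p)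
         (λ (m , p) → fromℕ< (bound m p) , trans (cong f (Fin.toℕ-fromℕ< (bound m p))) p)
         (λ (m , p) → Fibre-≡ (Fin.toℕ-fromℕ< (bound m p)))
         (λ (k , p) → Fibre-≡ (Fin.fromℕ<-toℕ k _)))
  (HasParity-Σ (λ m → HasParity-≡ (f m) n) (suc n))
  where
  bound : ∀ m → f m ≡ n → m < suc n
  bound m p = s≤s (subst (m ≤_) p (m≤f m))

-- Theta series modulo 2

open +-*-Solver using (Polynomial; con; _:+_; _:*_; _:-_; :-_; _:=_; solve)

∣_∣₂ : ℤ → Parity
∣ i ∣₂ = parity ℤ.∣ i ∣

private
  parity-suc : ∀ n → parity (suc n) ≡ parity n ℙ.⁻¹
  parity-suc n = trans (sym (ℙ.⁻¹-involutive _)) (cong ℙ._⁻¹ (ℙ.suc-homo-⁻¹ n))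

  parity-⊖ : ∀ m n → ∣ m ℤ.⊖ n ∣₂ ≡ parity m ⊕ parity n
  parity-⊖ zero    zero    = refl
  parity-⊖ zero    (suc n) = refl
  parity-⊖ (suc m) zero    = sym (ℙ.+-identityʳ _)
  parity-⊖ (suc m) (suc n) = begin
    ∣ suc m ℤ.⊖ suc n ∣₂               ≡⟨ cong ∣_∣₂ (ℤ.[1+m]⊖[1+n]≡m⊖n m n) ⟩
    ∣ m ℤ.⊖ n ∣₂                       ≡⟨ parity-⊖ m n ⟩
    parity m ⊕ parity n                ≡⟨ cancel (parity m) (parity n) ⟩
    parity m ℙ.⁻¹ ⊕ parity n ℙ.⁻¹      ≡⟨ cong₂ _⊕_ (parity-suc m) (parity-suc n) ⟨
    parity (suc m) ⊕ parity (suc n)    ∎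
    where
    cancel : ∀ p q → p ⊕ q ≡ p ℙ.⁻¹ ⊕ q ℙ.⁻¹
    cancel 0ℙ 0ℙ = refl
    cancel 0ℙ 1ℙ = refl
    cancel 1ℙ 0ℙ = refl
    cancel 1ℙ 1ℙ = refl

∣+∣₂ : ∀ i j → ∣ i ℤ.+ j ∣₂ ≡ ∣ i ∣₂ ⊕ ∣ j ∣₂
∣+∣₂ (+ m)    (+ n)    = ℙ.+-homo-+ m n
∣+∣₂ (+ m)    -[1+ n ] = parity-⊖ m (suc n)
∣+∣₂ -[1+ m ] (+ n)    = trans (parity-⊖ n (suc m)) (ℙ.+-comm (parity n) (parity (suc m)))
∣+∣₂ -[1+ m ] -[1+ n ] =
  trans (cong (parity ∘ suc) (sym (ℕ.+-suc m n))) (ℙ.+-homo-+ (suc m) (suc n))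

∣*∣₂ : ∀ i j → ∣ i ℤ.* j ∣₂ ≡ ∣ i ∣₂ ⊗ ∣ j ∣₂
∣*∣₂ i j = trans (cong parity (ℤ.abs-* i j)) (ℙ.*-homo-* ℤ.∣ i ∣ ℤ.∣ j ∣)

∣-∣₂ : ∀ i → ∣ ℤ.- i ∣₂ ≡ ∣ i ∣₂
∣-∣₂ i = cong parity (ℤ.∣-i∣≡∣i∣ i)

parity≡0ℙ⇒2∣ : ∀ n → parity n ≡ 0ℙ → 2 ∣ n
parity≡0ℙ⇒2∣ zero          p = divides 0 refl
parity≡0ℙ⇒2∣ (suc (suc n)) p with divides q r ← parity≡0ℙ⇒2∣ n p =
  divides (suc q) (cong (λ m → suc (suc m)) r)

tri-suc : ∀ n → tri (suc n) ≡ tri n + suc n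
tri-suc n = begin
  suc n * suc (suc n) / 2           ≡⟨ cong (_/ 2) (expand n) ⟩
  (n * suc n + suc n * 2) / 2       ≡⟨ +-distrib-/-∣ʳ (n * suc n) (n∣m*n (suc n)) ⟩
  n * suc n / 2 + suc n * 2 / 2     ≡⟨ cong (λ x → tri n + x) (m*n/n≡m (suc n) 2) ⟩
  tri n + suc n                     ∎
  where
  expand : ∀ n → suc n * suc (suc n) ≡ n * suc n + suc n * 2
  expand = ℕ-solve-∀

2*tri : ∀ n → 2 * tri n ≡ n * suc n
2*tri zero    = refl
2*tri (suc n) = begin
  2 * tri (suc n)       ≡⟨ cong (2 *_) (tri-suc n) ⟩
  2 * (tri n + suc n)   ≡⟨ ℕ.*-distribˡ-+ 2 (tri n) (suc n) ⟩
  2 * tri n + 2 * suc n ≡⟨ cong (_+ 2 * suc n) (2*tri n) ⟩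
  n * suc n + 2 * suc n ≡⟨ expand n ⟩
  suc n * suc (suc n)   ∎
  where
  expand : ∀ n → n * suc n + 2 * suc n ≡ suc n * suc (suc n)
  expand = ℕ-solve-∀

n≤tri : ∀ n → n ≤ tri n
n≤tri zero    = z≤n
n≤tri (suc n) rewrite tri-suc n = ℕ.m≤n+m (suc n) (tri n)

-- Modulo 2 the signs of Ψ disappear and its two sums merge into one over ℤ; `-[1+ m ]` is the index
-- -(m+1) of `expNeg`.
exponent : ℕ → ℕ → ℤ → ℕ
exponent r s (+ n)    = expPos r s n
exponent r s -[1+ m ] = expNeg r s m

-- Twice the exponent is a polynomial over ℤ, free of division and case distinction. Through
-- `2*-injective`, equalities of exponents become polynomial identities for the ring solver.
quadratic : ℤ → ℤ → ℤ → ℤ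
quadratic r s z = r ℤ.* (z ℤ.* (z ℤ.+ + 1)) ℤ.+ s ℤ.* (z ℤ.* (z ℤ.- + 1))

private
  +2*tri : ∀ n → + 2 ℤ.* + tri n ≡ + n ℤ.* + suc n
  +2*tri n = trans (sym (ℤ.pos-* 2 (tri n))) (trans (cong +_ (2*tri n)) (ℤ.pos-* n (suc n)))

  2*combination : ∀ r s m n →
    + 2 ℤ.* + (r * tri m + s * tri n) ≡ + r ℤ.* (+ m ℤ.* + suc m) ℤ.+ + s ℤ.* (+ n ℤ.* + suc n)
  2*combination r s m n = begin
    + 2 ℤ.* + (r * tri m + s * tri n)
      ≡⟨ cong (+ 2 ℤ.*_) (cong₂ ℤ._+_ (ℤ.pos-* r (tri m)) (ℤ.pos-* s (tri n))) ⟩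
    + 2 ℤ.* (+ r ℤ.* + tri m ℤ.+ + s ℤ.* + tri n)
      ≡⟨ factor (+ r) (+ s) (+ tri m) (+ tri n) ⟩
    + r ℤ.* (+ 2 ℤ.* + tri m) ℤ.+ + s ℤ.* (+ 2 ℤ.* + tri n)
      ≡⟨ cong₂ (λ x y → + r ℤ.* x ℤ.+ + s ℤ.* y) (+2*tri m) (+2*tri n) ⟩
    + r ℤ.* (+ m ℤ.* + suc m) ℤ.+ + s ℤ.* (+ n ℤ.* + suc n) ∎
    where
    factor : ∀ r s x y →
      + 2 ℤ.* (r ℤ.* x ℤ.+ s ℤ.* y) ≡ r ℤ.* (+ 2 ℤ.* x) ℤ.+ s ℤ.* (+ 2 ℤ.* y)
    factor = ℤ-solve-∀

2*exponent : ∀ r s z → + 2 ℤ.* + exponent r s z ≡ quadratic (+ r) (+ s) z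
2*exponent r s (+ zero)  = sym (cong₂ ℤ._+_ (ℤ.*-zeroʳ (+ r)) (ℤ.*-zeroʳ (+ s)))
2*exponent r s (+ suc n) = trans (2*combination r s (suc n) n) (rearrange (+ r) (+ s) (+ n))
  where
  rearrange : ∀ r s n → r ℤ.* ((+ 1 ℤ.+ n) ℤ.* (+ 2 ℤ.+ n)) ℤ.+ s ℤ.* (n ℤ.* (+ 1 ℤ.+ n))
            ≡ quadratic r s (+ 1 ℤ.+ n)
  rearrange = solve 3 (λ r s n →
    r :* ((con (+ 1) :+ n) :* (con (+ 2) :+ n)) :+ s :* (n :* (con (+ 1) :+ n)) :=
    r :* ((con (+ 1) :+ n) :* ((con (+ 1) :+ n) :+ con (+ 1)))
      :+ s :* ((con (+ 1) :+ n) :* ((con (+ 1) :+ n) :- con (+ 1)))) refl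
2*exponent r s -[1+ m ] = trans (2*combination r s m (suc m)) (rearrange (+ r) (+ s) (+ m))
  where
  rearrange : ∀ r s m → r ℤ.* (m ℤ.* (+ 1 ℤ.+ m)) ℤ.+ s ℤ.* ((+ 1 ℤ.+ m) ℤ.* (+ 2 ℤ.+ m))
            ≡ quadratic r s (ℤ.- (+ 1 ℤ.+ m))
  rearrange = solve 3 (λ r s m →
    r :* (m :* (con (+ 1) :+ m)) :+ s :* ((con (+ 1) :+ m) :* (con (+ 2) :+ m)) :=
    r :* ((:- (con (+ 1) :+ m)) :* ((:- (con (+ 1) :+ m)) :+ con (+ 1)))
      :+ s :* ((:- (con (+ 1) :+ m)) :* ((:- (con (+ 1) :+ m)) :- con (+ 1)))) refl

module _ (r s : ℕ) where

  positives negatives θ : Series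
  positives n = ∑ (λ m → χ (expPos r s m) n) (suc n)
  negatives n = ∑ (λ m → χ (expNeg r s m) n) (suc n)
  θ n = positives n ⊕ negatives n

  private
    ℤ↔ℕ⊎ℕ : (ℕ ⊎ ℕ) ↔ ℤ
    ℤ↔ℕ⊎ℕ = mk↔ₛ′ [ +_ , -[1+_] ]′ (λ { (+ n) → inj₁ n ; -[1+ n ] → inj₂ n })
      (λ { (+ n) → refl ; -[1+ n ] → refl }) (λ { (inj₁ n) → refl ; (inj₂ n) → refl })

  module _ {{_ : NonZero r}} {{_ : NonZero s}} where

    n≤expPos : ∀ n → n ≤ expPos r s n
    n≤expPos zero    = z≤n
    n≤expPos (suc n) = ℕ.≤-trans (n≤tri (suc n))
      (ℕ.≤-trans (ℕ.m≤n*m (tri (suc n)) r) (ℕ.m≤m+n _ (s * tri n)))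

    n<expNeg : ∀ n → n < expNeg r s n
    n<expNeg n = ℕ.≤-trans (n≤tri (suc n))
      (ℕ.≤-trans (ℕ.m≤n*m (tri (suc n)) s) (ℕ.m≤n+m _ (r * tri n)))

    θ-Counts : θ Counts exponent r s
    θ-Counts n = HasParity-↔
      (Fibre-reindex {f = [ expPos r s , expNeg r s ]′} ℤ↔ℕ⊎ℕ (λ { (inj₁ _) → refl ; (inj₂ _) → refl }) n)
      (Counts-⊎ (Counts-∑ n≤expPos) (Counts-∑ (ℕ.<⇒≤ ∘ n<expNeg)) n)

-- Reduction of Ψ and of its reciprocal modulo 2

∑-cong : ∀ {a b} → a ≗ b → ∀ m → ∑ a m ≡ ∑ b m
∑-cong p zero    = refl
∑-cong p (suc m) = cong₂ _⊕_ (p 0) (∑-cong (p ∘ suc) m)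

private
  sumℤ-applyUpTo : ∀ f (g : ℕ → ℕ) m →
    ∣ sumℤ (map f (applyUpTo g m)) ∣₂ ≡ ∑ (λ n → ∣ f (g n) ∣₂) m
  sumℤ-applyUpTo f g zero    = refl
  sumℤ-applyUpTo f g (suc m) =
    trans (∣+∣₂ (f (g 0)) _) (cong (∣ f (g 0) ∣₂ ⊕_) (sumℤ-applyUpTo f (g ∘ suc) m))

  ∣sgn∣₂ : ∀ n → ∣ sgn n ∣₂ ≡ 1ℙ
  ∣sgn∣₂ n with n % 2 ≡ᵇ 0
  ... | true  = refl
  ... | false = refl

  ∣when∣₂ : ∀ m n z → ∣ z ∣₂ ≡ 1ℙ → ∣ when m n z ∣₂ ≡ χ m n
  ∣when∣₂ m n z p with m ≡ᵇ n
  ... | true  = p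
  ... | false = refl

∣psiCoeff∣₂ : ∀ r s → ∣_∣₂ ∘ psiCoeff r s ≗ θ r s
∣psiCoeff∣₂ r s n = begin
  ∣ psiCoeff r s n ∣₂
    ≡⟨ ∣+∣₂ (sumℤ (map f (upTo (suc n)))) (sumℤ (map g (upTo (suc n)))) ⟩
  ∣ sumℤ (map f (upTo (suc n))) ∣₂ ⊕ ∣ sumℤ (map g (upTo (suc n))) ∣₂
    ≡⟨ cong₂ _⊕_ (sumℤ-applyUpTo f id (suc n)) (sumℤ-applyUpTo g id (suc n)) ⟩
  ∑ (∣_∣₂ ∘ f) (suc n) ⊕ ∑ (∣_∣₂ ∘ g) (suc n)
    ≡⟨ cong₂ _⊕_
         (∑-cong (λ m → ∣when∣₂ (expPos r s m) n (sgn (tri m)) (∣sgn∣₂ (tri m))) (suc n))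
         (∑-cong (λ m → ∣when∣₂ (expNeg r s m) n (ℤ.- sgn (tri m)) (trans (∣-∣₂ (sgn (tri m))) (∣sgn∣₂ (tri m)))) (suc n)) ⟩
  θ r s n ∎
  where
  f g : ℕ → ℤ
  f m = when (expPos r s m) n (sgn (tri m))
  g m = when (expNeg r s m) n (ℤ.- sgn (tri m))

module _ (r s : ℕ) where

  ∣c∣₂ : Series
  ∣c∣₂ n = ∣ c r s n ∣₂

  private
    sumℤ-zipWith : ∀ d (g : ℕ → ℕ) n →
      ∣ sumℤ (zipWith ℤ._*_ (map d (applyUpTo g (suc n))) (cList r s n)) ∣₂
      ≡ ((λ k → ∣ d (g k) ∣₂) ⊛ ∣c∣₂) n
    sumℤ-zipWith d g zero    = trans (cong ∣_∣₂ (ℤ.+-identityʳ (d (g 0) ℤ.* + 1))) (∣*∣₂ (d (g 0)) (+ 1))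
    sumℤ-zipWith d g (suc n) = trans (∣+∣₂ (d (g 0) ℤ.* c r s (suc n)) _)
      (cong₂ _⊕_ (∣*∣₂ (d (g 0)) (c r s (suc n))) (sumℤ-zipWith d (g ∘ suc) n))

  -- Modulo 2 the recursion for c(N) loses its minus sign, so c(N) equals the rest of the
  -- convolution and cancels it.
  c-inverse : ∣ psiCoeff r s 0 ∣₂ ≡ 1ℙ → θ r s ⊛ ∣c∣₂ ≗ δ
  c-inverse constant-term n = trans (⊛-cong {b = ∣c∣₂} (λ k → sym (∣psiCoeff∣₂ r s k)) (λ _ → refl) n) (inverse n)
    where
    d : ℕ → ℤ
    d = psiCoeff r s

    inverse : (∣_∣₂ ∘ d) ⊛ ∣c∣₂ ≗ δ
    inverse zero    = cong (_⊗ 1ℙ) constant-term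
    inverse (suc n) rewrite constant-term = begin
      ∣c∣₂ (suc n) ⊕ ((∣_∣₂ ∘ d ∘ suc) ⊛ ∣c∣₂) n
        ≡⟨ cong₂ _⊕_ (trans (∣-∣₂ (sumℤ (zipWith ℤ._*_ (map (d ∘ suc) (upTo (suc n))) (cList r s n)))) (sumℤ-zipWith (d ∘ suc) id n)) refl ⟩
      ((∣_∣₂ ∘ d ∘ suc) ⊛ ∣c∣₂) n ⊕ ((∣_∣₂ ∘ d ∘ suc) ⊛ ∣c∣₂) n
        ≡⟨ ℙ.p+p≡0ℙ (((∣_∣₂ ∘ d ∘ suc) ⊛ ∣c∣₂) n) ⟩
      0ℙ ∎

-- Shifts and dilations of counted series

q·_ : Series → Series
(q· a) zero    = 0ℙ
(q· a) (suc n) = a n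

q·-cong : ∀ {a b} → a ≗ b → q· a ≗ q· b
q·-cong p zero    = refl
q·-cong p (suc n) = p n

Counts-q· : {I : Set} {f : I → ℕ} {a : Series} → a Counts f → (q· a) Counts (suc ∘ f)
Counts-q· cf zero    = HasParity-empty λ ()
Counts-q· cf (suc n) = HasParity-↔
  (mk↔ₛ′ (λ (i , p) → i , cong suc p) (λ (i , p) → i , ℕ.suc-injective p)
         (λ _ → Fibre-≡ refl) (λ _ → Fibre-≡ refl))
  (cf n)

Counts-dilate : {I : Set} {f g : I → ℕ} {a b : Series} → (∀ i → g i ≡ f i * 2) →
  a Counts f → b Counts g → b ≗ dilate a
Counts-dilate {f = f} {g} {a} {b} g≡f*2 cf cg = dilate-unique a b
  (λ n → HasParity-unique (cg (n * 2)) (HasParity-↔ (even n) (cf n)))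
  (λ n → HasParity-unique (cg (suc (n * 2))) (HasParity-empty λ (i , p) → odd (f i) n (trans (sym (g≡f*2 i)) p)))
  where
  even : ∀ n → Fibre f n ↔ Fibre g (n * 2)
  even n = mk↔ₛ′ (λ (i , p) → i , trans (g≡f*2 i) (cong (_* 2) p))
    (λ (i , p) → i , ℕ.*-cancelʳ-≡ (f i) n 2 (trans (sym (g≡f*2 i)) p))
    (λ _ → Fibre-≡ refl) (λ _ → Fibre-≡ refl)

  odd : ∀ m n → ¬ m * 2 ≡ suc (n * 2)
  odd (suc m) (suc n) p = odd m n (ℕ.suc-injective (ℕ.suc-injective p))

module _ {a b d : Series} (a-split : ∀ n → a n ≡ dilate b n ⊕ (q· dilate d) n) where

  evens-split : evens a ≗ b
  evens-split n = begin
    a (n * 2)                                ≡⟨ a-split (n * 2) ⟩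
    dilate b (n * 2) ⊕ (q· dilate d) (n * 2) ≡⟨ cong₂ _⊕_ (evens-dilate b n) (vanish n) ⟩
    b n ⊕ 0ℙ                                 ≡⟨ ℙ.+-identityʳ (b n) ⟩
    b n                                      ∎
    where
    vanish : ∀ n → (q· dilate d) (n * 2) ≡ 0ℙ
    vanish zero    = refl
    vanish (suc n) = odds-dilate d n

  odds-split : odds a ≗ d
  odds-split n = trans (a-split (suc (n * 2))) (cong₂ _⊕_ (odds-dilate b n) (evens-dilate d n))

2*-injective : ∀ {m n} → + 2 ℤ.* + m ≡ + 2 ℤ.* + n → m ≡ n
2*-injective {m} {n} p = ℤ.+-injective (ℤ.*-cancelˡ-≡ (+ 2) (+ m) (+ n) p)

2*exponents : ∀ r s r′ s′ x y → + 2 ℤ.* + (exponent r s x + exponent r′ s′ y)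
  ≡ quadratic (+ r) (+ s) x ℤ.+ quadratic (+ r′) (+ s′) y
2*exponents r s r′ s′ x y = trans
  (ℤ.*-distribˡ-+ (+ 2) (+ exponent r s x) (+ exponent r′ s′ y))
  (cong₂ ℤ._+_ (2*exponent r s x) (2*exponent r′ s′ y))

2*exponent-suc : ∀ r s x →
  + 2 ℤ.* + suc (exponent r s x) ≡ + 2 ℤ.+ quadratic (+ r) (+ s) x
2*exponent-suc r s x = trans
  (ℤ.*-distribˡ-+ (+ 2) (+ 1) (+ exponent r s x)) (cong (λ e → + 2 ℤ.+ e) (2*exponent r s x))

2*exponents-suc : ∀ r s r′ s′ x y → + 2 ℤ.* + suc (exponent r s x + exponent r′ s′ y)
  ≡ + 2 ℤ.+ (quadratic (+ r) (+ s) x ℤ.+ quadratic (+ r′) (+ s′) y)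
2*exponents-suc r s r′ s′ x y = trans
  (ℤ.*-distribˡ-+ (+ 2) (+ 1) (+ (exponent r s x + exponent r′ s′ y)))
  (cong (λ e → + 2 ℤ.+ e) (2*exponents r s r′ s′ x y))

exponent-* : ∀ k r s z → exponent (r * k) (s * k) z ≡ exponent r s z * k
exponent-* k r s z = 2*-injective (begin
  + 2 ℤ.* + exponent (r * k) (s * k) z        ≡⟨ 2*exponent (r * k) (s * k) z ⟩
  quadratic (+ (r * k)) (+ (s * k)) z         ≡⟨ cong₂ (λ x y → quadratic x y z) (ℤ.pos-* r k) (ℤ.pos-* s k) ⟩
  quadratic (+ r ℤ.* + k) (+ s ℤ.* + k) z     ≡⟨ scale (+ k) (+ r) (+ s) z ⟩
  quadratic (+ r) (+ s) z ℤ.* + k             ≡⟨ cong (ℤ._* + k) (2*exponent r s z) ⟨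
  + 2 ℤ.* + exponent r s z ℤ.* + k            ≡⟨ ℤ.*-assoc (+ 2) (+ exponent r s z) (+ k) ⟩
  + 2 ℤ.* (+ exponent r s z ℤ.* + k)          ≡⟨ cong (+ 2 ℤ.*_) (ℤ.pos-* (exponent r s z) k) ⟨
  + 2 ℤ.* + (exponent r s z * k)              ∎)
  where
  scale : ∀ k r s z → quadratic (r ℤ.* k) (s ℤ.* k) z ≡ quadratic r s z ℤ.* k
  scale = solve 4 (λ k r s z →
    (r :* k) :* (z :* (z :+ con (+ 1))) :+ (s :* k) :* (z :* (z :- con (+ 1))) :=
    (r :* (z :* (z :+ con (+ 1))) :+ s :* (z :* (z :- con (+ 1)))) :* k) refl

θ-dilate : ∀ r s {{_ : NonZero r}} {{_ : NonZero s}} {{_ : NonZero (r * 2)}} {{_ : NonZero (s * 2)}} →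
  θ (r * 2) (s * 2) ≗ dilate (θ r s)
θ-dilate r s = Counts-dilate (exponent-* 2 r s) (θ-Counts r s) (θ-Counts (r * 2) (s * 2))

∑-suc : ∀ a n → ∑ a (suc n) ≡ ∑ a n ⊕ a n
∑-suc a zero    = ℙ.+-comm (a 0) 0ℙ
∑-suc a (suc n) = trans (cong (a 0 ⊕_) (∑-suc (a ∘ suc) n)) (sym (ℙ.+-assoc (a 0) _ _))

-- The terms of index n and -n of Σ q^(rn²) cancel modulo 2.
θ-square : ∀ r {{_ : NonZero r}} → θ r r ≗ δ
θ-square r n = begin
  χ 0 n ⊕ ∑ (λ m → χ (expPos r r (suc m)) n) n ⊕ negatives r r n
    ≡⟨ cong₂ (λ x y → χ 0 n ⊕ x ⊕ y) (∑-cong (λ m → cong (λ e → χ e n) (ℕ.+-comm (r * tri (suc m)) _)) n)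
             (∑-suc (λ m → χ (expNeg r r m) n) n) ⟩
  χ 0 n ⊕ S ⊕ (S ⊕ χ (expNeg r r n) n)
    ≡⟨ cong (λ x → χ 0 n ⊕ S ⊕ (S ⊕ x)) (χ-≢ (ℕ.>⇒≢ (n<expNeg r r n))) ⟩
  χ 0 n ⊕ S ⊕ (S ⊕ 0ℙ)
    ≡⟨ cong (χ 0 n ⊕ S ⊕_) (ℙ.+-identityʳ S) ⟩
  χ 0 n ⊕ S ⊕ S
    ≡⟨ ℙ.+-assoc (χ 0 n) S S ⟩
  χ 0 n ⊕ (S ⊕ S)
    ≡⟨ cong (χ 0 n ⊕_) (ℙ.p+p≡0ℙ S) ⟩
  χ 0 n ⊕ 0ℙ
    ≡⟨ ℙ.+-identityʳ (χ 0 n) ⟩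
  χ 0 n
    ≡⟨ χ-0 n ⟩
  δ n ∎
  where
  S : Parity
  S = ∑ (λ m → χ (expNeg r r m) n) n

  χ-0 : ∀ n → χ 0 n ≡ δ n
  χ-0 zero    = refl
  χ-0 (suc n) = refl

  χ-≢ : ∀ {m n} → ¬ m ≡ n → χ m n ≡ 0ℙ
  χ-≢ {m} {n} m≢n with m ≡ᵇ n in eq
  ... | true  = contradiction (ℕ.≡ᵇ⇒≡ m n (subst T (sym eq) tt)) m≢n
  ... | false = refl

euclid : ∀ k {{_ : NonZero k}} → (ℤ × Fin k) ↔ ℤ
euclid k = mk↔ₛ′ compose decompose compose-decompose
  (λ _ → compose-injective (compose-decompose _))
  where
  compose : ℤ × Fin k → ℤ
  compose (w , r) = + k ℤ.* w ℤ.+ + toℕ r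

  decompose : ℤ → ℤ × Fin k
  decompose z = z /ℕ k , fromℕ< (n%ℕd<d z k)

  compose-decompose : ∀ z → compose (decompose z) ≡ z
  compose-decompose z = begin
    + k ℤ.* (z /ℕ k) ℤ.+ + toℕ (fromℕ< (n%ℕd<d z k))
      ≡⟨ cong (λ r → + k ℤ.* (z /ℕ k) ℤ.+ + r) (Fin.toℕ-fromℕ< (n%ℕd<d z k)) ⟩
    + k ℤ.* (z /ℕ k) ℤ.+ + (z %ℕ k) ≡⟨ ℤ.+-comm (+ k ℤ.* (z /ℕ k)) _ ⟩
    + (z %ℕ k) ℤ.+ + k ℤ.* (z /ℕ k) ≡⟨ cong (λ x → + (z %ℕ k) ℤ.+ x) (ℤ.*-comm (+ k) (z /ℕ k)) ⟩
    + (z %ℕ k) ℤ.+ (z /ℕ k) ℤ.* + k ≡⟨ a≡a%ℕn+[a/ℕn]*n z k ⟨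
    z ∎

  compose-injective : ∀ {x y} → compose x ≡ compose y → x ≡ y
  compose-injective {w , r} {w′ , r′} p = cong₂ _,_ w≡w′ (Fin.toℕ-injective (ℤ.+-injective
    (∙-cancelˡ ℤ.+-0-abelianGroup (+ k ℤ.* w) _ _ (trans p (cong (λ v → + k ℤ.* v ℤ.+ + toℕ r′) (sym w≡w′))))))
    where
    difference : + k ℤ.* (w ℤ.- w′) ≡ toℕ r′ ℤ.⊖ toℕ r
    difference = begin
      + k ℤ.* (w ℤ.- w′)                                         ≡⟨ regroup (+ k) w w′ (+ toℕ r) ⟩
      (+ k ℤ.* w ℤ.+ + toℕ r) ℤ.- (+ k ℤ.* w′ ℤ.+ + toℕ r)       ≡⟨ cong (ℤ._- (+ k ℤ.* w′ ℤ.+ + toℕ r)) p ⟩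
      (+ k ℤ.* w′ ℤ.+ + toℕ r′) ℤ.- (+ k ℤ.* w′ ℤ.+ + toℕ r)     ≡⟨ cancel (+ k ℤ.* w′) (+ toℕ r′) (+ toℕ r) ⟩
      + toℕ r′ ℤ.- + toℕ r                                       ≡⟨ ℤ.m-n≡m⊖n (toℕ r′) (toℕ r) ⟩
      toℕ r′ ℤ.⊖ toℕ r                                           ∎
      where
      regroup : ∀ k w v r → k ℤ.* (w ℤ.- v) ≡ (k ℤ.* w ℤ.+ r) ℤ.- (k ℤ.* v ℤ.+ r)
      regroup = ℤ-solve-∀
      cancel : ∀ x r s → (x ℤ.+ r) ℤ.- (x ℤ.+ s) ≡ r ℤ.- s
      cancel = ℤ-solve-∀

    -- Both remainders lie below k, so their difference k(w - w′) has absolute value less than k,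
    -- which forces w = w′.
    small : k * ℤ.∣ w ℤ.- w′ ∣ < k * 1
    small = subst₂ _<_ (trans (cong ℤ.∣_∣ (sym difference)) (ℤ.abs-* (+ k) (w ℤ.- w′))) (sym (ℕ.*-identityʳ k))
      (ℕ.≤-<-trans (ℤ.∣m⊝n∣≤m⊔n (toℕ r′) (toℕ r)) (ℕ.⊔-lub (Fin.toℕ<n r′) (Fin.toℕ<n r)))

    w≡w′ : w ≡ w′
    w≡w′ = ℤ.i-j≡0⇒i≡j w w′ (ℤ.∣i∣≡0⇒i≡0 (ℕ.n<1⇒n≡0 (ℕ.*-cancelˡ-< k _ 1 small)))

-- Identities between theta series

euclid₂ : ∀ k {{_ : NonZero k}} → ((ℤ × ℤ) × Fin k) ↔ (ℤ × ℤ)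
euclid₂ k = mk↔ₛ′
  (λ ((x , w) , r) → x , to (euclid k) (w , r))
  (λ (x , z) → let (w , r) = from (euclid k) z in (x , w) , r)
  (λ (x , z) → cong (x ,_) (strictlyInverseˡ (euclid k) z))
  (λ ((x , w) , r) → cong (λ (w , r) → (x , w) , r) (strictlyInverseʳ (euclid k) (w , r)))

-- Allows a change of variables that depends on the residue class.
each : ∀ {A B : Set} {k} → (Fin k → A ↔ B) → (A × Fin k) ↔ (B × Fin k)
each e = mk↔ₛ′
  (λ (x , r) → to (e r) x , r) (λ (y , r) → from (e r) y , r)
  (λ (y , r) → cong (_, r) (strictlyInverseˡ (e r) y))
  (λ (x , r) → cong (_, r) (strictlyInverseʳ (e r) x))

infixr 9 _⨾_

_⨾_ : ∀ {A B C : Set} → A ↔ B → B ↔ C → A ↔ C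
_⨾_ = ↔-trans

private
  ℤ² : Set
  ℤ² = ℤ × ℤ

-- The symmetry of z(z+1), used where an odd class has to be traversed in the opposite direction.
reflection : ℤ ↔ ℤ
reflection = mk↔ₛ′ (λ z → ℤ.- z ℤ.- + 1) (λ z → ℤ.- z ℤ.- + 1) inverse inverse
  where
  inverse : ∀ z → ℤ.- (ℤ.- z ℤ.- + 1) ℤ.- + 1 ≡ z
  inverse = ℤ-solve-∀

Q : ∀ {n} → ℕ → ℕ → Polynomial n → Polynomial n
Q r s z = con (+ r) :* (z :* (z :+ con (+ 1))) :+ con (+ s) :* (z :* (z :- con (+ 1)))

# : ∀ {n} → ℕ → Polynomial n
# n = con (+ n)

-- The exponent of `θ 9 1` is 5n² + 4n. Even n = 2z gives 20z² + 8z, the exponent of `θ 28 12`; odd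
-- n = -1 - 2z gives 20z² + 12z + 1, one more than that of `θ 32 8`. The common factors 4 and 8
-- become two and three dilations.
θ₉₁-split : ∀ n → θ 9 1 n ≡ dilate (dilate (θ 7 3)) n ⊕ (q· dilate (dilate (dilate (θ 4 1)))) n
θ₉₁-split n = trans
  (sym (Counts-unique e degree split (θ-Counts 9 1) n))
  (cong₂ _⊕_
    (trans (θ-dilate 14 6 n) (dilate-cong (θ-dilate 7 3) n))
    (q·-cong (λ k → trans (θ-dilate 16 4 k)
      (dilate-cong (λ l → trans (θ-dilate 8 2 l) (dilate-cong (θ-dilate 4 1) l)) k)) n))
  where
  f : ℤ ⊎ ℤ → ℕ
  f = [ exponent 28 12 , suc ∘ exponent 32 8 ]′

  split : (λ n → θ 28 12 n ⊕ (q· θ 32 8) n) Counts f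
  split = Counts-⊎ (θ-Counts 28 12) (Counts-q· (θ-Counts 32 8))

  halves : (ℤ ⊎ ℤ) ↔ (ℤ × Fin 2)
  halves = mk↔ₛ′ [ (_, 0F) , (λ z → to reflection z , 1F) ]′
    (λ { (z , 0F) → inj₁ z ; (z , 1F) → inj₂ (to reflection z) })
    (λ { (z , 0F) → refl ; (z , 1F) → cong (_, 1F) (strictlyInverseˡ reflection z) })
    (λ { (inj₁ z) → refl ; (inj₂ z) → cong inj₂ (strictlyInverseˡ reflection z) })

  e : (ℤ ⊎ ℤ) ↔ ℤ
  e = halves ⨾ euclid 2

  degree : ∀ i → f i ≡ exponent 9 1 (to e i)
  degree (inj₁ z) = 2*-injective (trans (2*exponent 28 12 z) (trans
    (solve 1 (λ z → Q 28 12 z := Q 9 1 (# 2 :* z :+ # 0)) refl z)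
    (sym (2*exponent 9 1 (+ 2 ℤ.* z ℤ.+ + 0)))))
  degree (inj₂ z) = 2*-injective (trans (2*exponent-suc 32 8 z) (trans
    (solve 1 (λ z → # 2 :+ Q 32 8 z := Q 9 1 (# 2 :* (:- z :- # 1) :+ # 1)) refl z)
    (sym (2*exponent 9 1 (+ 2 ℤ.* (ℤ.- z ℤ.- + 1) ℤ.+ + 1)))))

-- From (n , l) with A = 10n+4, B = 10l+1 (or A = 10n+3, B = 10l+2) one passes to A+B = 5(2j+1)
-- and A-B = 10m+3 (or 10m+1), where j = n+l and m = n-l have the same parity.  Since
-- exponent 15 5 i is 5 j(j+1)/2 both for j = 2i and for j = -1-2i, the parity of m selects j.
module _ {f g : ℤ × ℤ → ℕ} {a b : Series} (cf : a Counts f) (cg : b Counts g)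
  (degree₀ : ∀ i w → f (w ℤ.+ i , + 2 ℤ.* i ℤ.+ + 0 ℤ.- (w ℤ.+ i)) ≡ g (i , + 2 ℤ.* w ℤ.+ + 0))
  (degree₁ : ∀ i w → f (w ℤ.- i , + 2 ℤ.* (ℤ.- i ℤ.- + 1) ℤ.+ + 1 ℤ.- (w ℤ.- i)) ≡ g (i , + 2 ℤ.* w ℤ.+ + 1))
  where

  private
    shear : Fin 2 → ℤ² ↔ ℤ²
    shear 0F = mk↔ₛ′ (λ (i , w) → w ℤ.+ i , i) (λ (n , v) → v , n ℤ.- v)
      (λ (n , v) → cong (_, v) (p n v)) (λ (i , w) → cong (i ,_) (q i w))
      where
      p : ∀ n v → n ℤ.- v ℤ.+ v ≡ n
      p = ℤ-solve-∀
      q : ∀ i w → w ℤ.+ i ℤ.- i ≡ w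
      q = ℤ-solve-∀
    shear 1F = mk↔ₛ′ (λ (i , w) → w ℤ.- i , ℤ.- i ℤ.- + 1) (λ (n , v) → ℤ.- v ℤ.- + 1 , n ℤ.- v ℤ.- + 1)
      (λ (n , v) → cong₂ _,_ (p n v) (strictlyInverseˡ reflection v))
      (λ (i , w) → cong₂ _,_ (strictlyInverseˡ reflection i) (q i w))
      where
      p : ∀ n v → n ℤ.- v ℤ.- + 1 ℤ.- (ℤ.- v ℤ.- + 1) ≡ n
      p = ℤ-solve-∀
      q : ∀ i w → w ℤ.- i ℤ.- (ℤ.- i ℤ.- + 1) ℤ.- + 1 ≡ w
      q = ℤ-solve-∀

    difference : ℤ² ↔ ℤ²
    difference = mk↔ₛ′ (λ (n , j) → n , j ℤ.- n) (λ (n , l) → n , l ℤ.+ n)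
      (λ (n , l) → cong (n ,_) (p n l)) (λ (n , j) → cong (n ,_) (q n j))
      where
      p : ∀ n l → l ℤ.+ n ℤ.- n ≡ l
      p = ℤ-solve-∀
      q : ∀ n j → j ℤ.- n ℤ.+ n ≡ j
      q = ℤ-solve-∀

  -- A triple ((i , w) , r) is read in two ways: `e` turns it into (n , l), and `euclid₂ 2` into (i
  -- , m) with m = 2w + r. The exponents `f` and `g` are compared on these triples.
  rotate : a ≗ b
  rotate n = trans (sym (Counts-unique e (λ _ → refl) c′ cf n))
    (Counts-unique (euclid₂ 2) (λ { ((i , w) , 0F) → degree₀ i w ; ((i , w) , 1F) → degree₁ i w }) c′ cg n)
    where
    e : (ℤ² × Fin 2) ↔ ℤ²
    e = each shear ⨾ euclid₂ 2 ⨾ difference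

    c′ : a Counts (f ∘ to e)
    c′ n = HasParity-↔ (↔-sym (Fibre-reindex e (λ _ → refl) n)) (cf n)

F-split : θ 9 1 ⊛ θ 6 4 ≗ θ 15 5 ⊛ θ 4 1
F-split = rotate (Counts-⊛ (θ-Counts 9 1) (θ-Counts 6 4)) (Counts-⊛ (θ-Counts 15 5) (θ-Counts 4 1))
  (λ i w → 2*-injective (trans (2*exponents 9 1 6 4 (w ℤ.+ i) (+ 2 ℤ.* i ℤ.+ + 0 ℤ.- (w ℤ.+ i)))
    (trans (solve 2 (λ i w → Q 9 1 (w :+ i) :+ Q 6 4 (# 2 :* i :+ # 0 :- (w :+ i))
                          := Q 15 5 i :+ Q 4 1 (# 2 :* w :+ # 0)) refl i w)
      (sym (2*exponents 15 5 4 1 i (+ 2 ℤ.* w ℤ.+ + 0))))))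
  (λ i w → 2*-injective (trans (2*exponents 9 1 6 4 (w ℤ.- i) (+ 2 ℤ.* (ℤ.- i ℤ.- + 1) ℤ.+ + 1 ℤ.- (w ℤ.- i)))
    (trans (solve 2 (λ i w → Q 9 1 (w :- i) :+ Q 6 4 (# 2 :* (:- i :- # 1) :+ # 1 :- (w :- i))
                          := Q 15 5 i :+ Q 4 1 (# 2 :* w :+ # 1)) refl i w)
      (sym (2*exponents 15 5 4 1 i (+ 2 ℤ.* w ℤ.+ + 1))))))

G-split : θ 8 2 ⊛ θ 7 3 ≗ θ 15 5 ⊛ θ 3 2
G-split = rotate (Counts-⊛ (θ-Counts 8 2) (θ-Counts 7 3)) (Counts-⊛ (θ-Counts 15 5) (θ-Counts 3 2))
  (λ i w → 2*-injective (trans (2*exponents 8 2 7 3 (w ℤ.+ i) (+ 2 ℤ.* i ℤ.+ + 0 ℤ.- (w ℤ.+ i)))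
    (trans (solve 2 (λ i w → Q 8 2 (w :+ i) :+ Q 7 3 (# 2 :* i :+ # 0 :- (w :+ i))
                          := Q 15 5 i :+ Q 3 2 (# 2 :* w :+ # 0)) refl i w)
      (sym (2*exponents 15 5 3 2 i (+ 2 ℤ.* w ℤ.+ + 0))))))
  (λ i w → 2*-injective (trans (2*exponents 8 2 7 3 (w ℤ.- i) (+ 2 ℤ.* (ℤ.- i ℤ.- + 1) ℤ.+ + 1 ℤ.- (w ℤ.- i)))
    (trans (solve 2 (λ i w → Q 8 2 (w :- i) :+ Q 7 3 (# 2 :* (:- i :- # 1) :+ # 1 :- (w :- i))
                          := Q 15 5 i :+ Q 3 2 (# 2 :* w :+ # 1)) refl i w)
      (sym (2*exponents 15 5 3 2 i (+ 2 ℤ.* w ℤ.+ + 1))))))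

-- Let ι² = -1, A = 4i+1 and B = 2j.  The values f (i , j), h (m , l) and g (x , y) are (N-1)/4,
-- where N is the norm of A+Bι, of (3m+l+1)+(m-3l)ι, and of (1+2ι)((4x+1)+2yι) respectively.
-- The last case is i+j ≡ 1 (mod 5); for each other residue of i+j, A+Bι is a fixed unit times
-- (3m+l+1)+(m-3l)ι, which confines (m , l) to one of four classes.
private
  module Gaussian where
    gaussian : (ℤ² ⊎ ((ℤ² × Fin 2) × Fin 2)) ↔ ℤ²
    gaussian = five ⨾ euclid₂ 5 ⨾ mk↔ₛ′ (λ (i , s) → i , s ℤ.- i) (λ (i , j) → i , j ℤ.+ i)
      (λ (i , j) → cong (i ,_) (p i j)) (λ (i , s) → cong (i ,_) (q i s))
      where
      p : ∀ i j → j ℤ.+ i ℤ.- i ≡ j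
      p = ℤ-solve-∀
      q : ∀ i s → s ℤ.- i ℤ.+ i ≡ s
      q = ℤ-solve-∀

      r : ∀ x y → x ℤ.- (x ℤ.- y) ≡ y
      r = ℤ-solve-∀

      five : (ℤ² ⊎ ((ℤ² × Fin 2) × Fin 2)) ↔ (ℤ² × Fin 5)
      five = mk↔ₛ′
        -- Expanding (1+2ι)((4x+1)+2yι) gives i = x - y and i + j = 5x + 1.
        (λ { (inj₁ (x , y))         → (x ℤ.- y , x) , 1F
           ; (inj₂ ((z , 0F) , 0F)) → z , 0F
           ; (inj₂ ((z , 1F) , 0F)) → z , 2F
           ; (inj₂ ((z , 0F) , 1F)) → z , 3F
           ; (inj₂ ((z , 1F) , 1F)) → z , 4F })
        (λ { (z , 0F)       → inj₂ ((z , 0F) , 0F)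
           ; ((i , t) , 1F) → inj₁ (t , t ℤ.- i)
           ; (z , 2F)       → inj₂ ((z , 1F) , 0F)
           ; (z , 3F)       → inj₂ ((z , 0F) , 1F)
           ; (z , 4F)       → inj₂ ((z , 1F) , 1F) })
        (λ { (z , 0F) → refl
           ; ((i , t) , 1F) → cong (λ i → (i , t) , 1F) (r t i)
           ; (z , 2F) → refl ; (z , 3F) → refl ; (z , 4F) → refl })
        (λ { (inj₁ (x , y)) → cong (λ y → inj₁ (x , y)) (r x y)
           ; (inj₂ ((z , 0F) , 0F)) → refl ; (inj₂ ((z , 1F) , 0F)) → refl
           ; (inj₂ ((z , 0F) , 1F)) → refl ; (inj₂ ((z , 1F) , 1F)) → refl })

    plus minus minus′ : ℤ² ↔ ℤ²
    plus = mk↔ₛ′ (λ (i , t) → i ℤ.+ t , t) (λ (m , w) → m ℤ.- w , w)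
      (λ (m , w) → cong (_, w) (p m w)) (λ (i , t) → cong (_, t) (q i t))
      where
      p : ∀ m w → m ℤ.- w ℤ.+ w ≡ m
      p = ℤ-solve-∀
      q : ∀ i t → i ℤ.+ t ℤ.- t ≡ i
      q = ℤ-solve-∀
    minus = mk↔ₛ′ (λ (i , t) → ℤ.- t ℤ.- + 1 ℤ.- i , ℤ.- t ℤ.- + 1) (λ (m , w) → w ℤ.- m , ℤ.- w ℤ.- + 1)
      (λ (m , w) → cong₂ _,_ (p m w) (strictlyInverseˡ reflection w))
      (λ (i , t) → cong₂ _,_ (q i t) (strictlyInverseˡ reflection t))
      where
      p : ∀ m w → ℤ.- (ℤ.- w ℤ.- + 1) ℤ.- + 1 ℤ.- (w ℤ.- m) ≡ m
      p = ℤ-solve-∀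
      q : ∀ i t → ℤ.- t ℤ.- + 1 ℤ.- (ℤ.- t ℤ.- + 1 ℤ.- i) ≡ i
      q = ℤ-solve-∀
    minus′ = mk↔ₛ′ (λ (i , t) → i ℤ.+ t ℤ.+ + 1 , t) (λ (l , w) → l ℤ.- w ℤ.- + 1 , w)
      (λ (l , w) → cong (_, w) (p l w)) (λ (i , t) → cong (_, t) (q i t))
      where
      p : ∀ l w → l ℤ.- w ℤ.- + 1 ℤ.+ w ℤ.+ + 1 ≡ l
      p = ℤ-solve-∀
      q : ∀ i t → i ℤ.+ t ℤ.+ + 1 ℤ.- t ℤ.- + 1 ≡ i
      q = ℤ-solve-∀

    -- With m + l = 2n + 1 and m - l = 2v + 1, this passes from the coordinates (l , n) to (m , v).
    turn : ℤ² ↔ ℤ²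
    turn = mk↔ₛ′ (λ (l , n) → + 2 ℤ.* n ℤ.+ + 1 ℤ.- l , n ℤ.- l)
      (λ (m , v) → m ℤ.- + 2 ℤ.* v ℤ.- + 1 , m ℤ.- v ℤ.- + 1)
      (λ (m , v) → cong₂ _,_ (p m v) (q m v)) (λ (l , n) → cong₂ _,_ (r l n) (s l n))
      where
      p : ∀ m v → + 2 ℤ.* (m ℤ.- v ℤ.- + 1) ℤ.+ + 1 ℤ.- (m ℤ.- + 2 ℤ.* v ℤ.- + 1) ≡ m
      p = ℤ-solve-∀
      q : ∀ m v → m ℤ.- v ℤ.- + 1 ℤ.- (m ℤ.- + 2 ℤ.* v ℤ.- + 1) ≡ v
      q = ℤ-solve-∀
      r : ∀ l n → + 2 ℤ.* n ℤ.+ + 1 ℤ.- l ℤ.- + 2 ℤ.* (n ℤ.- l) ℤ.- + 1 ≡ l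
      r = ℤ-solve-∀
      s : ∀ l n → + 2 ℤ.* n ℤ.+ + 1 ℤ.- l ℤ.- (n ℤ.- l) ℤ.- + 1 ≡ n
      s = ℤ-solve-∀

    -- If m - l is even, the real part of (3m+l+1)+(m-3l)ι is odd and congruent to 1 - (m - l)
    -- modulo 4; otherwise the imaginary part is odd and congruent to m + l modulo 4. Hence the
    -- outer index is the parity of m - l, and the inner one sorts by m - l or by m + l modulo 4:
    -- together they determine the unit.
    quarters : ((ℤ² × Fin 2) × Fin 2) ↔ ℤ²
    quarters = each (λ { 0F → each (λ { 0F → plus ; 1F → minus }) ⨾ euclid₂ 2
                       ; 1F → each (λ { 0F → minus ; 1F → minus′ }) ⨾ euclid₂ 2 ⨾ turn })
      ⨾ euclid₂ 2
      ⨾ mk↔ₛ′ (λ (m , d) → m , m ℤ.- d) (λ (m , l) → m , m ℤ.- l)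
          (λ (m , l) → cong (m ,_) (p m l)) (λ (m , d) → cong (m ,_) (p m d))
      where
      p : ∀ m d → m ℤ.- (m ℤ.- d) ≡ d
      p = ℤ-solve-∀

    f g h : ℤ² → ℕ
    f (i , j) = exponent 6 2 i + exponent 1 1 j
    g (x , y) = suc (exponent 30 10 x + exponent 5 5 y)
    h (m , l) = exponent 4 1 m + exponent 3 2 l

    sum : ℤ² ⊎ ((ℤ² × Fin 2) × Fin 2) → ℕ
    sum = [ g , h ∘ to quarters ]′

    degree-g : ∀ z → g z ≡ f (to gaussian (inj₁ z))
    degree-g (x , y) = 2*-injective (trans (2*exponents-suc 30 10 5 5 x y) (trans
      (solve 2 (λ x y → # 2 :+ (Q 30 10 x :+ Q 5 5 y)
        := Q 6 2 (x :- y) :+ Q 1 1 (# 5 :* x :+ # 1 :- (x :- y))) refl x y)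
      (sym (2*exponents 6 2 1 1 (x ℤ.- y) (+ 5 ℤ.* x ℤ.+ + 1 ℤ.- (x ℤ.- y))))))

    degree-h : ∀ z → h (to quarters z) ≡ f (to gaussian (inj₂ z))
    degree-h (((i , t) , a) , b) = 2*-injective (trans
      (2*exponents 4 1 3 2 (proj₁ (ml a b)) (proj₂ (ml a b)))
      (trans (poly a b) (sym (2*exponents 6 2 1 1 (proj₁ (ij a b)) (proj₂ (ij a b))))))
      where
      ml ij : Fin 2 → Fin 2 → ℤ²
      ml a b = to quarters (((i , t) , a) , b)
      ij a b = to gaussian (inj₂ (((i , t) , a) , b))

      poly : ∀ a b → quadratic (+ 4) (+ 1) (proj₁ (ml a b)) ℤ.+ quadratic (+ 3) (+ 2) (proj₂ (ml a b))
        ≡ quadratic (+ 6) (+ 2) (proj₁ (ij a b)) ℤ.+ quadratic (+ 1) (+ 1) (proj₂ (ij a b))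
      poly 0F 0F = solve 2 (λ i t →
        let m = i :+ t ; v = # 2 :* t :+ # 0 in
        Q 4 1 m :+ Q 3 2 (m :- (# 2 :* v :+ # 0)) := Q 6 2 i :+ Q 1 1 (# 5 :* t :+ # 0 :- i)) refl i t
      poly 1F 0F = solve 2 (λ i t →
        let m = :- t :- # 1 :- i ; v = # 2 :* (:- t :- # 1) :+ # 1 in
        Q 4 1 m :+ Q 3 2 (m :- (# 2 :* v :+ # 0)) := Q 6 2 i :+ Q 1 1 (# 5 :* t :+ # 2 :- i)) refl i t
      poly 0F 1F = solve 2 (λ i t →
        let l = :- t :- # 1 :- i ; n = # 2 :* (:- t :- # 1) :+ # 0 ; m = # 2 :* n :+ # 1 :- l ; v = n :- l in
        Q 4 1 m :+ Q 3 2 (m :- (# 2 :* v :+ # 1)) := Q 6 2 i :+ Q 1 1 (# 5 :* t :+ # 3 :- i)) refl i t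
      poly 1F 1F = solve 2 (λ i t →
        let l = i :+ t :+ # 1 ; n = # 2 :* t :+ # 1 ; m = # 2 :* n :+ # 1 :- l ; v = n :- l in
        Q 4 1 m :+ Q 3 2 (m :- (# 2 :* v :+ # 1)) := Q 6 2 i :+ Q 1 1 (# 5 :* t :+ # 4 :- i)) refl i t

    counts-sum : (λ n → (q· (θ 30 10 ⊛ θ 5 5)) n ⊕ (θ 4 1 ⊛ θ 3 2) n) Counts sum
    counts-sum = Counts-⊎ (Counts-q· (Counts-⊛ (θ-Counts 30 10) (θ-Counts 5 5)))
      (λ n → HasParity-↔ (↔-sym (Fibre-reindex quarters (λ _ → refl) n)) (Counts-⊛ (θ-Counts 4 1) (θ-Counts 3 2) n))

    identity : ∀ n → (q· (θ 30 10 ⊛ θ 5 5)) n ⊕ (θ 4 1 ⊛ θ 3 2) n ≡ (θ 6 2 ⊛ θ 1 1) n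
    identity = Counts-unique gaussian [ degree-g , degree-h ] counts-sum (Counts-⊛ (θ-Counts 6 2) (θ-Counts 1 1))

-- In `Gaussian.identity` the factors `θ 1 1` and `θ 5 5` equal 1 by `θ-square`, which pairs an
-- index with its negative, that is, a number with its conjugate. The remaining shifted term changes
-- sides because it is its own negative.
θ₄₁⊛θ₃₂-split : ∀ n → (θ 4 1 ⊛ θ 3 2) n ≡ dilate (θ 3 1) n ⊕ (q· dilate (θ 15 5)) n
θ₄₁⊛θ₃₂-split n = begin
  KL                       ≡⟨ cong (_⊕ KL) (ℙ.p+p≡0ℙ x) ⟨
  x ⊕ x ⊕ KL               ≡⟨ ℙ.+-assoc x x KL ⟩
  x ⊕ (x ⊕ KL)             ≡⟨ cong (λ y → x ⊕ (y ⊕ KL)) (unfold n) ⟨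
  x ⊕ ((q· (θ 30 10 ⊛ θ 5 5)) n ⊕ KL)
                           ≡⟨ cong (x ⊕_) (Gaussian.identity n) ⟩
  x ⊕ (θ 6 2 ⊛ θ 1 1) n    ≡⟨ cong (x ⊕_) (⊛-cong {a = θ 6 2} (λ _ → refl) (θ-square 1) n) ⟩
  x ⊕ (θ 6 2 ⊛ δ) n        ≡⟨ cong (x ⊕_) (trans (⊛-identityʳ (θ 6 2) n) (θ-dilate 3 1 n)) ⟩
  x ⊕ dilate (θ 3 1) n     ≡⟨ ℙ.+-comm x _ ⟩
  dilate (θ 3 1) n ⊕ x     ∎
  where
  KL x : Parity
  KL = (θ 4 1 ⊛ θ 3 2) n
  x = (q· dilate (θ 15 5)) n
  unfold : q· (θ 30 10 ⊛ θ 5 5) ≗ q· dilate (θ 15 5)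
  unfold = q·-cong λ k → trans (⊛-cong {a = θ 30 10} (λ _ → refl) (θ-square 5) k)
    (trans (⊛-identityʳ (θ 30 10) k) (θ-dilate 15 5 k))

-- The coefficients c(8n+2) and c(8n+6)

private
  C : Series
  C = ∣c∣₂ 9 1

quarter : odds (evens C) ≗ dilate (θ 3 2) ⊛ (θ 4 1 ⊛ θ 3 2)
quarter = quarter-dissection
  (λ n → trans (⊛-comm C (θ 9 1) n) (c-inverse 9 1 refl n))
  (evens-split θ₉₁-split) (odds-split {b = dilate (θ 7 3)} θ₉₁-split)
  (λ n → trans (⊛-cong {a = θ 9 1} (λ _ → refl) (λ k → sym (θ-dilate 3 2 k)) n)
    (trans (F-split n) (⊛-comm (θ 15 5) (θ 4 1) n)))
  (λ n → trans (⊛-comm (θ 7 3) (dilate (θ 4 1)) n)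
    (trans (⊛-cong {b = θ 7 3} (λ k → sym (θ-dilate 4 1 k)) (λ _ → refl) n)
    (trans (G-split n) (⊛-comm (θ 15 5) (θ 3 2) n))))

-- The index 8n + 2 is spelled so that the nested `evens` and `odds` evaluate to it by definition;
-- likewise 8n + 6 below.
c-8n+2 : ∀ n → ∣c∣₂ 9 1 (suc (n * 2 * 2) * 2) ≡ (θ 3 2 ⊛ θ 3 1) n
c-8n+2 n = begin
  evens (odds (evens C)) n                          ≡⟨ quarter (n * 2) ⟩
  evens (dilate (θ 3 2) ⊛ (θ 4 1 ⊛ θ 3 2)) n        ≡⟨ evens-dilate-⊛ (θ 3 2) (θ 4 1 ⊛ θ 3 2) n ⟩
  (θ 3 2 ⊛ evens (θ 4 1 ⊛ θ 3 2)) n                 ≡⟨ ⊛-cong {a = θ 3 2} (λ _ → refl) (evens-split θ₄₁⊛θ₃₂-split) n ⟩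
  (θ 3 2 ⊛ θ 3 1) n                                 ∎

c-8n+6 : ∀ n → ∣c∣₂ 9 1 (suc (suc (n * 2) * 2) * 2) ≡ (θ 3 2 ⊛ θ 15 5) n
c-8n+6 n = begin
  odds (odds (evens C)) n                           ≡⟨ quarter (suc (n * 2)) ⟩
  odds (dilate (θ 3 2) ⊛ (θ 4 1 ⊛ θ 3 2)) n         ≡⟨ odds-dilate-⊛ (θ 3 2) (θ 4 1 ⊛ θ 3 2) n ⟩
  (θ 3 2 ⊛ odds (θ 4 1 ⊛ θ 3 2)) n                  ≡⟨ ⊛-cong {a = θ 3 2} (λ _ → refl) (odds-split {b = θ 3 1} θ₄₁⊛θ₃₂-split) n ⟩
  (θ 3 2 ⊛ θ 15 5) n                                ∎

-- The forms x² + y² and x² + 5y²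

floor-sqrt : ∀ n → ∃ λ s → s * s ≤ n × n < suc s * suc s
floor-sqrt zero    = 0 , z≤n , s≤s z≤n
floor-sqrt (suc n) with s , s²≤n , n<[1+s]² ← floor-sqrt n with suc s * suc s ≤? suc n
... | yes [1+s]²≤1+n = suc s , [1+s]²≤1+n ,
  ℕ.≤-<-trans n<[1+s]² (ℕ.*-mono-< (ℕ.n<1+n (suc s)) (ℕ.n<1+n (suc s)))
... | no  [1+s]²≰1+n = s , ℕ.m≤n⇒m≤1+n s²≤n , ℕ.≰⇒> [1+s]²≰1+n

Form : ℕ → ℤ → ℤ → ℤ
Form d x y = x ℤ.* x ℤ.+ + d ℤ.* (y ℤ.* y)

Form-abs : ∀ d x y → Form d x y ≡ + (ℤ.∣ x ∣ * ℤ.∣ x ∣ + d * (ℤ.∣ y ∣ * ℤ.∣ y ∣))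
Form-abs d x y = cong₂ ℤ._+_ (square x) (trans (cong (+ d ℤ.*_) (square y)) (sym (ℤ.pos-* d _)))
  where
  square : ∀ z → z ℤ.* z ≡ + (ℤ.∣ z ∣ * ℤ.∣ z ∣)
  square (+ n)    = sym (ℤ.pos-* n n)
  square -[1+ n ] = refl

module _ {p : ℕ} (p-prime : Prime p) where

  private
    instance
      p≢0 : NonZero p
      p≢0 = prime⇒nonZero p-prime

  euclid-ℤ : ∀ x y → + p ∣ₛ x ℤ.* y → + p ∣ₛ x ⊎ + p ∣ₛ y
  euclid-ℤ x y p∣xy with euclidsLemma ℤ.∣ x ∣ ℤ.∣ y ∣ p-prime (subst (p ∣_) (ℤ.abs-* x y) (∣⇒∣ᵤ p∣xy))
  ... | inj₁ p∣x = inj₁ (∣ᵤ⇒∣ p∣x)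
  ... | inj₂ p∣y = inj₂ (∣ᵤ⇒∣ p∣y)

  %ℕ≡⇒∣ : ∀ x y → x %ℕ p ≡ y %ℕ p → + p ∣ₛ x ℤ.- y
  %ℕ≡⇒∣ x y e = dividesₛ (x /ℕ p ℤ.- y /ℕ p) (begin
    x ℤ.- y
      ≡⟨ cong₂ ℤ._-_ (a≡a%ℕn+[a/ℕn]*n x p) (a≡a%ℕn+[a/ℕn]*n y p) ⟩
    (+ (x %ℕ p) ℤ.+ (x /ℕ p) ℤ.* + p) ℤ.- (+ (y %ℕ p) ℤ.+ (y /ℕ p) ℤ.* + p)
      ≡⟨ cong (λ r → (+ (x %ℕ p) ℤ.+ (x /ℕ p) ℤ.* + p) ℤ.- (+ r ℤ.+ (y /ℕ p) ℤ.* + p)) e ⟨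
    (+ (x %ℕ p) ℤ.+ (x /ℕ p) ℤ.* + p) ℤ.- (+ (x %ℕ p) ℤ.+ (y /ℕ p) ℤ.* + p)
      ≡⟨ cancel (+ (x %ℕ p)) (x /ℕ p) (y /ℕ p) (+ p) ⟩
    (x /ℕ p ℤ.- y /ℕ p) ℤ.* + p ∎)
    where
    cancel : ∀ r a b m → (r ℤ.+ a ℤ.* m) ℤ.- (r ℤ.+ b ℤ.* m) ≡ (a ℤ.- b) ℤ.* m
    cancel = ℤ-solve-∀

  residue : ℤ → Fin p
  residue x = fromℕ< (n%ℕd<d x p)

  residue≡⇒∣ : ∀ x y → residue x ≡ residue y → + p ∣ₛ x ℤ.- y
  residue≡⇒∣ x y e = %ℕ≡⇒∣ x y (begin
    x %ℕ p           ≡⟨ Fin.toℕ-fromℕ< (n%ℕd<d x p) ⟨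
    toℕ (residue x)  ≡⟨ cong toℕ e ⟩
    toℕ (residue y)  ≡⟨ Fin.toℕ-fromℕ< (n%ℕd<d y p) ⟩
    y %ℕ p           ∎)

  private
    difference : ∀ {s} → Fin (suc s) → Fin (suc s) → ℤ
    difference x y = + toℕ x ℤ.- + toℕ y

    ∣difference∣≤ : ∀ {s} (x y : Fin (suc s)) → ℤ.∣ difference x y ∣ ≤ s
    ∣difference∣≤ {s} x y = subst (_≤ s) (cong ℤ.∣_∣ (sym (ℤ.m-n≡m⊖n (toℕ x) (toℕ y))))
      (ℕ.≤-trans (ℤ.∣m⊝n∣≤m⊔n (toℕ x) (toℕ y)) (ℕ.⊔-lub (s≤s⁻¹ (Fin.toℕ<n x)) (s≤s⁻¹ (Fin.toℕ<n y))))

    difference≡0 : ∀ {s} (x y : Fin (suc s)) → difference x y ≡ + 0 → x ≡ y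
    difference≡0 x y e = Fin.toℕ-injective (ℤ.+-injective (ℤ.i-j≡0⇒i≡j (+ toℕ x) (+ toℕ y) e))

  Thue : ℤ → ℤ → Set
  Thue X Y = ∃ λ U → ∃ λ V → ¬ (U ≡ + 0 × V ≡ + 0) × + p ∣ₛ U ℤ.* Y ℤ.- V ℤ.* X ×
    ℤ.∣ U ∣ * ℤ.∣ U ∣ ≤ p × ℤ.∣ V ∣ * ℤ.∣ V ∣ ≤ p

  -- Pigeonhole: with s the integer part of √p there are (s+1)² > p pairs (x , y) with entries from
  -- 0 to s, so two of the values xY - yX agree modulo p. The difference of these two pairs is (U ,
  -- V).
  thue : ∀ X Y → Thue X Y
  thue X Y with s , s²≤p , p<[1+s]² ← floor-sqrt p = search s s²≤p (suc s * suc s) refl p<[1+s]²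
    where
    regroup : ∀ x y x′ y′ X Y → (x ℤ.* Y ℤ.- y ℤ.* X) ℤ.- (x′ ℤ.* Y ℤ.- y′ ℤ.* X)
      ≡ (x ℤ.- x′) ℤ.* Y ℤ.- (y ℤ.- y′) ℤ.* X
    regroup = ℤ-solve-∀

    module _ (s : ℕ) (s²≤p : s * s ≤ p) where
      value : Fin (suc s) × Fin (suc s) → ℤ
      value (x , y) = + toℕ x ℤ.* Y ℤ.- + toℕ y ℤ.* X

      collision : ∀ z z′ → ¬ z ≡ z′ → residue (value z) ≡ residue (value z′) → Thue X Y
      collision (x , y) (x′ , y′) z≢z′ e = difference x x′ , difference y y′
        , (λ (U≡0 , V≡0) → z≢z′ (cong₂ _,_ (difference≡0 x x′ U≡0) (difference≡0 y y′ V≡0)))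
        , subst (+ p ∣ₛ_) (regroup (+ toℕ x) (+ toℕ y) (+ toℕ x′) (+ toℕ y′) X Y)
            (residue≡⇒∣ (value (x , y)) (value (x′ , y′)) e)
        , ℕ.≤-trans (ℕ.*-mono-≤ (∣difference∣≤ x x′) (∣difference∣≤ x x′)) s²≤p
        , ℕ.≤-trans (ℕ.*-mono-≤ (∣difference∣≤ y y′) (∣difference∣≤ y y′)) s²≤p

      coords : ∀ {n} → n ≡ suc s * suc s → Fin n → Fin (suc s) × Fin (suc s)
      coords n≡ i = remQuot (suc s) (subst Fin n≡ i)

      coords-injective : ∀ {n} (n≡ : n ≡ suc s * suc s) {i j} → coords n≡ i ≡ coords n≡ j → i ≡ j
      coords-injective n≡ {i} {j} e = subst-injective n≡ (begin
        subst Fin n≡ i                 ≡⟨ Fin.combine-remQuot {suc s} (suc s) (subst Fin n≡ i) ⟨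
        uncurry combine (coords n≡ i)  ≡⟨ cong (uncurry combine) e ⟩
        uncurry combine (coords n≡ j)  ≡⟨ Fin.combine-remQuot {suc s} (suc s) (subst Fin n≡ j) ⟩
        subst Fin n≡ j                 ∎)

      search : ∀ n → n ≡ suc s * suc s → p < n → Thue X Y
      search n n≡ p<n with i , j , i<j , e ← Fin.pigeonhole p<n (λ i → residue (value (coords n≡ i))) =
        collision (coords n≡ i) (coords n≡ j) (λ c → Fin.<⇒≢ i<j (coords-injective n≡ c)) e

  Anisotropic : ℕ → Set
  Anisotropic d = ∀ x y → + p ∣ₛ Form d x y → + p ∣ₛ x × + p ∣ₛ y

  module _ (d : ℕ) {{_ : NonZero d}}
    (no-multiple : ∀ a b k → 0 < k → k ≤ suc d → ¬ a * a + d * (b * b) ≡ k * p) where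

    private
      -- Here 0 < U² + dV² ≤ (d+1)p, so divisibility by p would produce a multiple that
      -- `no-multiple` excludes.
      no-small-form : ∀ U V → ¬ (U ≡ + 0 × V ≡ + 0) → ℤ.∣ U ∣ * ℤ.∣ U ∣ ≤ p → ℤ.∣ V ∣ * ℤ.∣ V ∣ ≤ p →
        ¬ p ∣ ℤ.∣ U ∣ * ℤ.∣ U ∣ + d * (ℤ.∣ V ∣ * ℤ.∣ V ∣)
      no-small-form U V UV≢0 U²≤p V²≤p (divides zero e) =
        UV≢0 (zero-square U (ℕ.m+n≡0⇒m≡0 _ e) , zero-square V
          ([ (λ d≡0 → contradiction d≡0 (≢-nonZero⁻¹ d)) , id ]′
            (ℕ.m*n≡0⇒m≡0∨n≡0 d (ℕ.m+n≡0⇒n≡0 (ℤ.∣ U ∣ * ℤ.∣ U ∣) e))))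
        where
        zero-square : ∀ z → ℤ.∣ z ∣ * ℤ.∣ z ∣ ≡ 0 → z ≡ + 0
        zero-square z e = ℤ.∣i∣≡0⇒i≡0 ([ id , id ]′ (ℕ.m*n≡0⇒m≡0∨n≡0 ℤ.∣ z ∣ e))
      no-small-form U V UV≢0 U²≤p V²≤p (divides (suc k) e) =
        no-multiple ℤ.∣ U ∣ ℤ.∣ V ∣ (suc k) (s≤s z≤n)
          (ℕ.*-cancelʳ-≤ (suc k) (suc d) p
            (subst (_≤ suc d * p) e (ℕ.+-mono-≤ U²≤p (ℕ.*-monoʳ-≤ d V²≤p)))) e

      cancel : ∀ {y z} → ¬ + p ∣ₛ y → + p ∣ₛ y ℤ.* z → + p ∣ₛ z
      cancel {y} {z} p∤y p∣yz = [ (λ p∣y → contradiction p∣y p∤y) , id ]′ (euclid-ℤ y z p∣yz)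

      -- Y²(U² + dV²) = (UY - VX)(UY + VX) + V²(X² + dY²), and Y is cancelled twice.
      transfer : ∀ X Y U V → ¬ + p ∣ₛ Y → + p ∣ₛ U ℤ.* Y ℤ.- V ℤ.* X → + p ∣ₛ Form d X Y → + p ∣ₛ Form d U V
      transfer X Y U V p∤Y p∣UY-VX p∣F = cancel p∤Y (cancel p∤Y (subst (+ p ∣ₛ_) (key (+ d) X Y U V)
        (∣m∣n⇒∣m+n (∣m⇒∣m*n (U ℤ.* Y ℤ.+ V ℤ.* X) p∣UY-VX) (∣n⇒∣m*n (V ℤ.* V) p∣F))))
        where
        key : ∀ d X Y U V → (U ℤ.* Y ℤ.- V ℤ.* X) ℤ.* (U ℤ.* Y ℤ.+ V ℤ.* X) ℤ.+ V ℤ.* V ℤ.* (X ℤ.* X ℤ.+ d ℤ.* (Y ℤ.* Y))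
          ≡ Y ℤ.* (Y ℤ.* (U ℤ.* U ℤ.+ d ℤ.* (V ℤ.* V)))
        key = ℤ-solve-∀

      not-indivisible : ∀ X Y → + p ∣ₛ Form d X Y → Thue X Y → ¬ ¬ + p ∣ₛ Y
      not-indivisible X Y p∣F (U , V , UV≢0 , p∣UY-VX , U²≤p , V²≤p) p∤Y =
        no-small-form U V UV≢0 U²≤p V²≤p
          (∣⇒∣ᵤ (subst (+ p ∣ₛ_) (Form-abs d U V) (transfer X Y U V p∤Y p∣UY-VX p∣F)))

      divides-left : ∀ X Y → + p ∣ₛ Form d X Y → + p ∣ₛ Y → + p ∣ₛ X
      divides-left X Y p∣F p∣Y = [ id , id ]′ (euclid-ℤ X X (subst (+ p ∣ₛ_) (remove (X ℤ.* X) (+ d ℤ.* (Y ℤ.* Y)))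
        (∣m∣n⇒∣m-n p∣F (∣n⇒∣m*n (+ d) (∣m⇒∣m*n Y p∣Y)))))
        where
        remove : ∀ x y → x ℤ.+ y ℤ.- y ≡ x
        remove = ℤ-solve-∀

    anisotropic : Anisotropic d
    anisotropic X Y p∣F = divides-left X Y p∣F p∣Y , p∣Y
      where
      p∣Y : + p ∣ₛ Y
      -- Thue's lemma only refutes p ∤ Y; decidability of divisibility makes this positive.
      p∣Y = decidable-stable (+ p ∣ₛ? Y) (not-indivisible X Y p∣F (thue X Y))

  -- Descent: p divides x and y, hence p² divides the form, and the exponent 2k + 1 drops by 2 until
  -- a single p is left.
  odd-valuation : ∀ d → Anisotropic d → ∀ k {x y u} → Form d x y ≡ + (p ^ suc (2 * k) * u) → p ∣ u
  odd-valuation d aniso k {x} {y} {u} e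
    with aniso x y (subst (+ p ∣ₛ_) (sym e) (∣ᵤ⇒∣ (subst (p ∣_) (sym (ℕ.*-assoc p (p ^ (2 * k)) u)) (m∣m*n _))))
  ... | dividesₛ x′ refl , dividesₛ y′ refl = descend k reduced
    where
    factor : ∀ d p x y → p ℤ.* ((x ℤ.* x ℤ.+ d ℤ.* (y ℤ.* y)) ℤ.* p)
      ≡ (x ℤ.* p) ℤ.* (x ℤ.* p) ℤ.+ d ℤ.* ((y ℤ.* p) ℤ.* (y ℤ.* p))
    factor = ℤ-solve-∀

    -- Only one of the two factors p is cancelled: for k = 0 the other one shows p ∣ u, and for
    -- larger k `descend` cancels it.
    reduced : Form d x′ y′ ℤ.* + p ≡ + (p ^ (2 * k) * u)
    reduced = ℤ.*-cancelˡ-≡ (+ p) _ _ (begin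
      + p ℤ.* (Form d x′ y′ ℤ.* + p)             ≡⟨ factor (+ d) (+ p) x′ y′ ⟩
      Form d (x′ ℤ.* + p) (y′ ℤ.* + p)           ≡⟨ e ⟩
      + (p * p ^ (2 * k) * u)                    ≡⟨ cong +_ (ℕ.*-assoc p (p ^ (2 * k)) u) ⟩
      + (p * (p ^ (2 * k) * u))                  ≡⟨ ℤ.pos-* p _ ⟩
      + p ℤ.* + (p ^ (2 * k) * u)                ∎)

    descend : ∀ k → Form d x′ y′ ℤ.* + p ≡ + (p ^ (2 * k) * u) → p ∣ u
    descend zero    e = subst (p ∣_) (ℕ.+-identityʳ u) (∣⇒∣ᵤ (dividesₛ (Form d x′ y′) (sym e)))
    descend (suc k) e = odd-valuation d aniso k {x′} {y′} (ℤ.*-cancelʳ-≡ _ _ (+ p) (begin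
      Form d x′ y′ ℤ.* + p                       ≡⟨ e ⟩
      + (p ^ (2 * suc k) * u)                    ≡⟨ cong (λ m → + (p ^ m * u)) (ℕ.*-suc 2 k) ⟩
      + (p * p ^ suc (2 * k) * u)                ≡⟨ cong +_ (rotate-factors p (p ^ suc (2 * k)) u) ⟩
      + (p ^ suc (2 * k) * u * p)                ≡⟨ ℤ.pos-* (p ^ suc (2 * k) * u) p ⟩
      + (p ^ suc (2 * k) * u) ℤ.* + p            ∎))
      where
      rotate-factors : ∀ a b c → a * b * c ≡ b * c * a
      rotate-factors = ℕ-solve-∀

-- Congruence obstructions to small multiples of p

avoids? : ∀ m d r {{_ : NonZero m}} → Dec (∀ (i j : Fin m) → ¬ (toℕ i * toℕ i + d * (toℕ j * toℕ j)) % m ≡ r)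
avoids? m d r = Fin.all? λ i → Fin.all? λ j → ¬? (_ ℕ.≟ r)

form-% : ∀ m d a b {{_ : NonZero m}} → (a * a + d * (b * b)) % m ≡ ((a % m) * (a % m) + d * ((b % m) * (b % m))) % m
form-% m d a b = begin
  (a * a + d * (b * b)) % m
    ≡⟨ cong₂ (λ x y → (x * x + d * (y * y)) % m) (m≡m%n+[m/n]*n a m) (m≡m%n+[m/n]*n b m) ⟩
  ((a % m + a / m * m) * (a % m + a / m * m) + d * ((b % m + b / m * m) * (b % m + b / m * m))) % m
    ≡⟨ cong (_% m) (regroup (a % m) (b % m) (a / m) (b / m) m d) ⟩
  (((a % m) * (a % m) + d * ((b % m) * (b % m))) + multiple (a % m) (b % m) (a / m) (b / m) * m) % m
    ≡⟨ [m+kn]%n≡m%n ((a % m) * (a % m) + d * ((b % m) * (b % m))) (multiple (a % m) (b % m) (a / m) (b / m)) m ⟩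
  ((a % m) * (a % m) + d * ((b % m) * (b % m))) % m ∎
  where
  multiple : ℕ → ℕ → ℕ → ℕ → ℕ
  multiple i j q t = 2 * i * q + q * q * m + d * (2 * j * t + t * t * m)

  regroup : ∀ i j q t m d → (i + q * m) * (i + q * m) + d * ((j + t * m) * (j + t * m))
    ≡ (i * i + d * (j * j)) + (2 * i * q + q * q * m + d * (2 * j * t + t * t * m)) * m
  regroup = ℕ-solve-∀

-- The progression r + 20ℕ only fixes k p modulo 20k, whence the condition that m divides 20k.
no-representation : ∀ m d k t r q {{_ : NonZero m}} → k * 20 ≡ t * m → {_ : True (avoids? m d (k * r % m))} →
  ∀ a b → ¬ a * a + d * (b * b) ≡ k * (r + q * 20)
no-representation m d k t r q 20k≡tm {avoid} a b e =
  toWitness avoid (fromℕ< (m%n<n a m)) (fromℕ< (m%n<n b m)) (begin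
    (toℕ i * toℕ i + d * (toℕ j * toℕ j)) % m
      ≡⟨ cong₂ (λ x y → (x * x + d * (y * y)) % m) (Fin.toℕ-fromℕ< (m%n<n a m)) (Fin.toℕ-fromℕ< (m%n<n b m)) ⟩
    ((a % m) * (a % m) + d * ((b % m) * (b % m))) % m ≡⟨ form-% m d a b ⟨
    (a * a + d * (b * b)) % m                         ≡⟨ cong (_% m) e ⟩
    k * (r + q * 20) % m                              ≡⟨ cong (_% m) (expand k r q) ⟩
    (k * r + q * (k * 20)) % m                        ≡⟨ cong (λ x → (k * r + q * x) % m) 20k≡tm ⟩
    (k * r + q * (t * m)) % m                         ≡⟨ cong (λ x → (k * r + x) % m) (ℕ.*-assoc q t m) ⟨
    (k * r + q * t * m) % m                           ≡⟨ [m+kn]%n≡m%n (k * r) (q * t) m ⟩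
    k * r % m                                         ∎)
  where
  i j : Fin m
  i = fromℕ< (m%n<n a m)
  j = fromℕ< (m%n<n b m)

  expand : ∀ k r q → k * (r + q * 20) ≡ k * r + q * (k * 20)
  expand = ℕ-solve-∀

-- Both residues are 3 modulo 4, so p is 3 modulo 4 and 2p is 6 modulo 8; sums of two squares avoid
-- these classes.
no-small-multiple₁ : ∀ {r} → r ≡ 11 ⊎ r ≡ 19 → ∀ q a b k → 0 < k → k ≤ 2 → ¬ a * a + 1 * (b * b) ≡ k * (r + q * 20)
no-small-multiple₁ (inj₁ refl) q a b 1 _ _ = no-representation 4 1 1 5 11 q refl a b
no-small-multiple₁ (inj₁ refl) q a b 2 _ _ = no-representation 8 1 2 5 11 q refl a b
no-small-multiple₁ (inj₂ refl) q a b 1 _ _ = no-representation 4 1 1 5 19 q refl a b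
no-small-multiple₁ (inj₂ refl) q a b 2 _ _ = no-representation 8 1 2 5 19 q refl a b
no-small-multiple₁ _ q a b (suc (suc (suc k))) _ (s≤s (s≤s ()))

-- As p is 3 modulo 4, p and 5p are 3 modulo 4, 4p is 12 modulo 16 and 6p is 2 modulo 8. As p is ±1
-- modulo 5, 2p and 3p are ±2 modulo 5, hence non-squares. The form x² + 5y² avoids all these
-- classes.
no-small-multiple₅ : ∀ {r} → r ≡ 11 ⊎ r ≡ 19 → ∀ q a b k → 0 < k → k ≤ 6 → ¬ a * a + 5 * (b * b) ≡ k * (r + q * 20)
no-small-multiple₅ (inj₁ refl) q a b 1 _ _ = no-representation 4  5 1 5 11 q refl a b
no-small-multiple₅ (inj₁ refl) q a b 2 _ _ = no-representation 5  5 2 8 11 q refl a b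
no-small-multiple₅ (inj₁ refl) q a b 3 _ _ = no-representation 5  5 3 12 11 q refl a b
no-small-multiple₅ (inj₁ refl) q a b 4 _ _ = no-representation 16 5 4 5 11 q refl a b
no-small-multiple₅ (inj₁ refl) q a b 5 _ _ = no-representation 4  5 5 25 11 q refl a b
no-small-multiple₅ (inj₁ refl) q a b 6 _ _ = no-representation 8  5 6 15 11 q refl a b
no-small-multiple₅ (inj₂ refl) q a b 1 _ _ = no-representation 4  5 1 5 19 q refl a b
no-small-multiple₅ (inj₂ refl) q a b 2 _ _ = no-representation 5  5 2 8 19 q refl a b
no-small-multiple₅ (inj₂ refl) q a b 3 _ _ = no-representation 5  5 3 12 19 q refl a b
no-small-multiple₅ (inj₂ refl) q a b 4 _ _ = no-representation 16 5 4 5 19 q refl a b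
no-small-multiple₅ (inj₂ refl) q a b 5 _ _ = no-representation 4  5 5 25 19 q refl a b
no-small-multiple₅ (inj₂ refl) q a b 6 _ _ = no-representation 8  5 6 15 19 q refl a b
no-small-multiple₅ _ q a b (suc (suc (suc (suc (suc (suc (suc k))))))) _ (s≤s (s≤s (s≤s (s≤s (s≤s (s≤s ()))))))

-- 121 = 1 + 3·40 and 361 = 1 + 9·40, while the other terms 40rq + 400q² of the square are multiples
-- of 40.
square≡1 : ∀ {r} → r ≡ 11 ⊎ r ≡ 19 → ∀ {p} q → p ≡ r + q * 20 → ∃ λ h → p * p ≡ 1 + h * 40
square≡1 (inj₁ refl) q refl = 3 + 11 * q + 10 * q * q , expand q
  where
  expand : ∀ q → (11 + q * 20) * (11 + q * 20) ≡ 1 + (3 + 11 * q + 10 * q * q) * 40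
  expand = ℕ-solve-∀
square≡1 (inj₂ refl) q refl = 9 + 19 * q + 10 * q * q , expand q
  where
  expand : ∀ q → (19 + q * 20) * (19 + q * 20) ≡ 1 + (9 + 19 * q + 10 * q * q) * 40
  expand = ℕ-solve-∀

module _ {p : ℕ} (p-prime : Prime p) (p%20 : p % 20 ≡ 11 ⊎ p % 20 ≡ 19) where

  private
    p≡ : p ≡ p % 20 + p / 20 * 20
    p≡ = m≡m%n+[m/n]*n p 20

    p²≡1 : ∃ λ h → p * p ≡ 1 + h * 40
    p²≡1 = square≡1 p%20 (p / 20) p≡

  anisotropic₁ : Anisotropic p-prime 1
  anisotropic₁ = anisotropic p-prime 1 λ a b k 0<k k≤2 e →
    no-small-multiple₁ p%20 (p / 20) a b k 0<k k≤2 (trans e (cong (k *_) p≡))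

  anisotropic₅ : Anisotropic p-prime 5
  anisotropic₅ = anisotropic p-prime 5 λ a b k 0<k k≤6 e →
    no-small-multiple₅ p%20 (p / 20) a b k 0<k k≤6 (trans e (cong (k *_) p≡))

  p^[2k]≡1 : ∀ k → ∃ λ g → p ^ (2 * k) ≡ 1 + g * 40
  p^[2k]≡1 zero    = 0 , refl
  p^[2k]≡1 (suc k) with g , e ← p^[2k]≡1 k with h , f ← p²≡1 =
    h + g + h * g * 40 , (begin
      p ^ (2 * suc k)               ≡⟨ cong (p ^_) (ℕ.*-suc 2 k) ⟩
      p * (p * p ^ (2 * k))         ≡⟨ ℕ.*-assoc p p _ ⟨
      p * p * p ^ (2 * k)           ≡⟨ cong₂ _*_ f e ⟩
      (1 + h * 40) * (1 + g * 40)   ≡⟨ expand h g ⟩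
      1 + (h + g + h * g * 40) * 40 ∎)
    where
    expand : ∀ h g → (1 + h * 40) * (1 + g * 40) ≡ 1 + (h + g + h * g * 40) * 40
    expand = ℕ-solve-∀

  -- A divisor of 40 is at most 40, which leaves a finite check by evaluation.
  p∤40 : ¬ p ∣ 40
  p∤40 p∣40 = impossible (fromℕ< (s≤s (∣⇒≤ p∣40))) (subst (_∣ 40) (sym p≡i) p∣40)
    ([ (λ r → inj₁ (trans (cong (_% 20) p≡i) r)) , (λ r → inj₂ (trans (cong (_% 20) p≡i) r)) ]′ p%20)
    where
    p≡i : toℕ (fromℕ< (s≤s (∣⇒≤ p∣40))) ≡ p
    p≡i = Fin.toℕ-fromℕ< (s≤s (∣⇒≤ p∣40))

    impossible : ∀ (i : Fin 41) → toℕ i ∣ 40 → ¬ (toℕ i % 20 ≡ 11 ⊎ toℕ i % 20 ≡ 19)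
    impossible = toWitness {a? = Fin.all? λ i → (toℕ i ∣? 40) →-dec ¬? ((toℕ i % 20 ℕ.≟ 11) ⊎-dec (toℕ i % 20 ℕ.≟ 19))} tt

  -- By `odd-valuation`, p would divide 40n + wp, hence 40n, hence 40 or n.
  not-odd-valuation : ∀ d {n} → Anisotropic p-prime d → ¬ p ∣ n → ∀ k w x y →
    ¬ Form d x y ≡ + (p ^ suc (2 * k) * (40 * n + w * p))
  not-odd-valuation d {n} aniso p∤n k w x y e
    with euclidsLemma 40 n p-prime (∣m+n∣m⇒∣n (subst (p ∣_) (ℕ.+-comm (40 * n) (w * p)) (odd-valuation p-prime d aniso k {x} {y} e)) (n∣m*n w))
  ... | inj₁ p∣40 = p∤40 p∣40
  ... | inj₂ p∣n  = p∤n p∣n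

-- Congruences

vanishes : {I : Set} {f : I → ℕ} {a : Series} → a Counts f → ∀ n → (∀ i → ¬ f i ≡ n) → a n ≡ 0ℙ
vanishes cf n f≢n = HasParity-unique (cf n) (HasParity-empty λ (i , p) → f≢n i p)

private
  +[40*n+w] : ∀ n w → + (40 * n + w) ≡ + 20 ℤ.* (+ 2 ℤ.* + n) ℤ.+ + w
  +[40*n+w] n w = cong (ℤ._+ + w) (trans (ℤ.pos-* 40 n) (ℤ.*-assoc (+ 20) (+ 2) (+ n)))

  40-exponents : ∀ r s r′ s′ x y w → + (40 * (exponent r s x + exponent r′ s′ y) + w)
    ≡ + 20 ℤ.* (quadratic (+ r) (+ s) x ℤ.+ quadratic (+ r′) (+ s′) y) ℤ.+ + w
  40-exponents r s r′ s′ x y w = trans (+[40*n+w] (exponent r s x + exponent r′ s′ y) w)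
    (cong (λ e → + 20 ℤ.* e ℤ.+ + w) (2*exponents r s r′ s′ x y))

-- Completing squares: 40 times the exponents of `θ 3 2` and `θ 3 1` are (10j+1)² - 1 and 5(4i+1)² -
-- 5, and 6 = 1 + 5.
θ₃₂⊛θ₃₁-vanishes : ∀ n → (∀ x y → ¬ Form 5 x y ≡ + (40 * n + 6)) → (θ 3 2 ⊛ θ 3 1) n ≡ 0ℙ
θ₃₂⊛θ₃₁-vanishes n no-solution = vanishes (Counts-⊛ (θ-Counts 3 2) (θ-Counts 3 1)) n λ (j , i) e →
  no-solution (+ 10 ℤ.* j ℤ.+ + 1) (+ 4 ℤ.* i ℤ.+ + 1) (sym (trans (cong (λ m → + (40 * m + 6)) (sym e))
    (trans (40-exponents 3 2 3 1 j i 6) (complete j i))))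
  where
  complete : ∀ j i → + 20 ℤ.* (quadratic (+ 3) (+ 2) j ℤ.+ quadratic (+ 3) (+ 1) i) ℤ.+ + 6
    ≡ Form 5 (+ 10 ℤ.* j ℤ.+ + 1) (+ 4 ℤ.* i ℤ.+ + 1)
  complete = solve 2 (λ j i →
    let x = con (+ 10) :* j :+ con (+ 1) ; y = con (+ 4) :* i :+ con (+ 1) in
    con (+ 20) :* (Q 3 2 j :+ Q 3 1 i) :+ con (+ 6) := x :* x :+ con (+ 5) :* (y :* y)) refl

-- Here 40 times the exponent of `θ 15 5` is (20i+5)² - 25, and 26 = 1 + 25.
θ₃₂⊛θ₁₅₅-vanishes : ∀ n → (∀ x y → ¬ Form 1 x y ≡ + (40 * n + 26)) → (θ 3 2 ⊛ θ 15 5) n ≡ 0ℙ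
θ₃₂⊛θ₁₅₅-vanishes n no-solution = vanishes (Counts-⊛ (θ-Counts 3 2) (θ-Counts 15 5)) n λ (j , i) e →
  no-solution (+ 10 ℤ.* j ℤ.+ + 1) (+ 20 ℤ.* i ℤ.+ + 5) (sym (trans (cong (λ m → + (40 * m + 26)) (sym e))
    (trans (40-exponents 3 2 15 5 j i 26) (complete j i))))
  where
  complete : ∀ j i → + 20 ℤ.* (quadratic (+ 3) (+ 2) j ℤ.+ quadratic (+ 15) (+ 5) i) ℤ.+ + 26
    ≡ Form 1 (+ 10 ℤ.* j ℤ.+ + 1) (+ 20 ℤ.* i ℤ.+ + 5)
  complete = solve 2 (λ j i →
    let x = con (+ 10) :* j :+ con (+ 1) ; y = con (+ 20) :* i :+ con (+ 5) in
    con (+ 20) :* (Q 3 2 j :+ Q 15 5 i) :+ con (+ 26) := x :* x :+ con (+ 1) :* (y :* y)) refl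

2∣c-8n+2 : ∀ n {m} → m ≡ suc (n * 2 * 2) * 2 → (∀ x y → ¬ Form 5 x y ≡ + (40 * n + 6)) → + 2 ∣ℤ c 9 1 m
2∣c-8n+2 n refl no-solution =
  parity≡0ℙ⇒2∣ _ (trans (c-8n+2 n) (θ₃₂⊛θ₃₁-vanishes n no-solution))

2∣c-8n+6 : ∀ n {m} → m ≡ suc (suc (n * 2) * 2) * 2 → (∀ x y → ¬ Form 1 x y ≡ + (40 * n + 26)) → + 2 ∣ℤ c 9 1 m
2∣c-8n+6 n refl no-solution =
  parity≡0ℙ⇒2∣ _ (trans (c-8n+6 n) (θ₃₂⊛θ₁₅₅-vanishes n no-solution))

module _ {p : ℕ} (p-prime : Prime p) (p%20 : p % 20 ≡ 11 ⊎ p % 20 ≡ 19) {n : ℕ} (p∤n : ¬ p ∣ n) (k : ℕ) where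

  private
    g : ℕ
    g = proj₁ (p^[2k]≡1 p-prime p%20 (suc k))

    A : ℕ
    A = p ^ suc (2 * k)

    p*A≡ : p * A ≡ 1 + g * 40
    p*A≡ = trans (cong (p ^_) (sym (ℕ.*-suc 2 k))) (proj₂ (p^[2k]≡1 p-prime p%20 (suc k)))

    -- Since pA = 1 + 40g, the number represented is A(40n + wp): an odd power of p times a factor
    -- prime to p.
    no-solution : ∀ d → Anisotropic p-prime d → ∀ w x y → ¬ Form d x y ≡ + (40 * (A * n + w * g) + w)
    no-solution d aniso w x y e = not-odd-valuation p-prime p%20 d aniso p∤n k w x y (trans e (cong +_ (begin
      40 * (A * n + w * g) + w        ≡⟨ expand A n w g ⟩
      A * (40 * n) + w * (1 + g * 40) ≡⟨ cong (λ x → A * (40 * n) + w * x) p*A≡ ⟨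
      A * (40 * n) + w * (p * A)      ≡⟨ collect A n w p ⟩
      A * (40 * n + w * p)            ∎)))
      where
      expand : ∀ A n w g → 40 * (A * n + w * g) + w ≡ A * (40 * n) + w * (1 + g * 40)
      expand = ℕ-solve-∀
      collect : ∀ A n w p → A * (40 * n) + w * (p * A) ≡ A * (40 * n + w * p)
      collect = ℕ-solve-∀

    -- As p^(2k+2) = 1 + 40g, the division by 5 is exact. Its quotient `v` is 2 + 48g for w = 6 and
    -- 6 + 208g for w = 26, so the arguments of c are 8N + 2 and 8N + 6 with N = An + wg.
    argument : ∀ w v m → w * (1 + g * 40) + 4 ≡ v * 5 → 8 * A * n + v ≡ m →
      8 * p ^ (2 * k + 1) * n + (w * p ^ (2 * k + 2) + 4) / 5 ≡ m
    argument w v m e₁ e₂ = trans (cong₂ _+_ (cong (λ l → 8 * p ^ l * n) (ℕ.+-comm (2 * k) 1)) (begin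
      (w * p ^ (2 * k + 2) + 4) / 5 ≡⟨ cong (λ l → (w * p ^ l + 4) / 5) (ℕ.+-comm (2 * k) 2) ⟩
      (w * (p * A) + 4) / 5         ≡⟨ cong (λ P → (w * P + 4) / 5) p*A≡ ⟩
      (w * (1 + g * 40) + 4) / 5    ≡⟨ cong (_/ 5) e₁ ⟩
      v * 5 / 5                     ≡⟨ m*n/n≡m v 5 ⟩
      v                             ∎)) e₂

  argument₆ : 8 * p ^ (2 * k + 1) * n + (6 * p ^ (2 * k + 2) + 4) / 5 ≡ suc ((A * n + 6 * g) * 2 * 2) * 2
  argument₆ = argument 6 (2 + g * 48) _ (quotient g) (index A n g)
    where
    quotient : ∀ g → 6 * (1 + g * 40) + 4 ≡ (2 + g * 48) * 5
    quotient = ℕ-solve-∀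
    index : ∀ A n g → 8 * A * n + (2 + g * 48) ≡ suc ((A * n + 6 * g) * 2 * 2) * 2
    index = ℕ-solve-∀

  argument₂₆ : 8 * p ^ (2 * k + 1) * n + (26 * p ^ (2 * k + 2) + 4) / 5 ≡ suc (suc ((A * n + 26 * g) * 2) * 2) * 2
  argument₂₆ = argument 26 (6 + g * 208) _ (quotient g) (index A n g)
    where
    quotient : ∀ g → 26 * (1 + g * 40) + 4 ≡ (6 + g * 208) * 5
    quotient = ℕ-solve-∀
    index : ∀ A n g → 8 * A * n + (6 + g * 208) ≡ suc (suc ((A * n + 26 * g) * 2) * 2) * 2
    index = ℕ-solve-∀

  2∣c₆ : + 2 ∣ℤ c 9 1 (8 * p ^ (2 * k + 1) * n + (6 * p ^ (2 * k + 2) + 4) / 5)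
  2∣c₆ = 2∣c-8n+2 (A * n + 6 * g) argument₆ (no-solution 5 (anisotropic₅ p-prime p%20) 6)

  2∣c₂₆ : + 2 ∣ℤ c 9 1 (8 * p ^ (2 * k + 1) * n + (26 * p ^ (2 * k + 2) + 4) / 5)
  2∣c₂₆ = 2∣c-8n+6 (A * n + 26 * g) argument₂₆ (no-solution 1 (anisotropic₁ p-prime p%20) 26)

theorem2p1 : (p : ℕ) → Prime p → (p % 20 ≡ 11 ⊎ p % 20 ≡ 19) →
    (n k : ℕ) → ¬ (p ∣ n) →
    (+ 2 ∣ℤ c 9 1 (8 * p ^ (2 * k + 1) * n + (6 * p ^ (2 * k + 2) + 4) / 5))
    × (+ 2 ∣ℤ c 9 1 (8 * p ^ (2 * k + 1) * n + (26 * p ^ (2 * k + 2) + 4) / 5))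
theorem2p1 p p-prime p%20 n k p∤n = 2∣c₆ p-prime p%20 p∤n k , 2∣c₂₆ p-prime p%20 p∤n k
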